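{- Let $A$ be a finite alphabet. The subspace $\mathrm{QSym}_A$ of $\Bbbk[x_A]$ spanned by the series $M_I$, where $I$ runs over all sentences over $A$, is a subalgebra isomorphic to the graded dual algebra $(\mathrm{NSym}_A)^{gr}$, with the isomorphism given by $M_I\leftrightarrow H_I^*$.
   Context: $\Bbbk$ is a field of characteristic zero. A sentence $I=(w_1,\dots,w_m)$ over $A$ is a finite sequence of non-empty words in letters of $A$; $1$ is the empty sentence; $|I|$ is the total number of letters; $I\cdot J$ is concatenation of sequences of words. $\mathrm{NSym}_A$ is the Hopf algebra over $\Bbbk$ with linear basis $(H_I)$ indexed by sentences, graded by $|I|$, with product $H_I\cdot H_J=H_{I\cdot J}$ and coproduct $\Delta(H_I)=\sum_{J\subset I}H_{\widetilde{I\setminus J}}\otimes H_{\widetilde J}$. Here, for $I=(w_1,\dots,w_m)$, $J=(v_1,\dots,v_m)$ runs over sequences of possibly empty words such that $w_i=u_iv_i$ for some words $u_i$; $I\setminus J=(u_1,\dots,u_m)$; and tilde means deleting the empty words. Its graded dual $(\mathrm{NSym}_A)^{gr}$ has the basis $(H_I^*)$ dual to $(H_I)$, and its product is dual to $\Delta$, i.e. $\langle fg,h\rangle=\langle f\otimes g,\Delta(h)\rangle$. Partially commutative variables: $x_A=\{x_{a,i}: a\in A,\ i=1,2,3,\dots\}$, each variable of degree $1$, subject to the relations $x_{a,i}x_{b,j}=x_{b,j}x_{a,i}$ for $i\ne j$ and $a,b\in A$ only (for $a\neq b$ the variables $x_{a,i}$ and $x_{b,i}$ do not commute). $\Bbbk[x_A]$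 is the algebra of formal (possibly infinite) $\Bbbk$-linear combinations, of bounded degree, of monomials in these variables, with the natural multiplication. For a word $w=a_{i_1}\cdots a_{i_k}$ and $j\ge 1$ put $x_{w,j}=x_{a_{i_1},j}x_{a_{i_2},j}\cdots x_{a_{i_k},j}$. For a sentence $I=(w_1,\dots,w_m)$ put $$M_I=\sum_{1\le j_1<j_2<\dots<j_m}x_{w_1,j_1}x_{w_2,j_2}\cdots x_{w_m,j_m},\qquad M_1=1 .$$ -}

module Defs where

open import Level using (Level; _⊔_) renaming (suc to lsuc)
open import Algebra.Apartness.Bundles using (HeytingField; HeytingCommutativeRing)
open import Algebra.Bundles using (CommutativeRing)
open import Algebra.Bundles.Raw using (RawRing)
open import Algebra.Core using (Op₁; Op₂)
open import Algebra.Module.Bundles.Raw using (RawLeftModule)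
open import Algebra.Module.Core using (Opₗ)
import Algebra.Module.Construct.TensorUnit as TensorUnit
open import Algebra.Module.Morphism.Structures using (module LeftModuleMorphisms)
open import Algebra.Morphism.Structures using (module RingMorphisms)
import Algebra.Definitions.RawMonoid as RawMonoidDefs
import Algebra.Properties.Ring as RingProperties
import Algebra.Properties.CommutativeSemigroup as CommutativeSemigroupProperties
open import Data.Bool.Base using (if_then_else_; true; false)
open import Data.Empty using (⊥-elim)
open import Data.Fin.Base using (Fin)
open import Data.Fin.Properties using (inj⇒≟)
open import Data.List.Base
  using (List; []; _∷_; [_]; _++_; map; concat; concatMap; filter; foldr; length;
         mapMaybe; upTo; zipWith; cartesianProductWith; deduplicate)
import Data.List.Properties as List
open import Data.List.Membership.Propositional using (_∈_; _∉_)
open import Data.List.Membership.Propositional.Properties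
  using (∈-++⁺ˡ; ∈-++⁺ʳ; ∈-map⁺; ∈-deduplicate⁺)
open import Data.List.NonEmpty.Base using (List⁺; _∷_; fromList; toList)
open import Data.List.Relation.Unary.All as All using (All; []; _∷_; all?)
import Data.List.Relation.Unary.All.Properties as All
open import Data.List.Relation.Unary.AllPairs as AllPairs using (AllPairs; []; _∷_)
import Data.List.Relation.Unary.AllPairs.Properties as AllPairs
open import Data.List.Relation.Unary.Any using (Any; here; there)
import Data.List.Relation.Unary.Any.Properties as Any
import Data.List.Relation.Unary.Any as Any
open import Data.List.Relation.Unary.Linked using (Linked; linked?)
open import Data.List.Relation.Unary.Unique.Propositional using (Unique)
import Data.List.Relation.Unary.Unique.DecPropositional.Properties as Unique
open import Data.Maybe.Base using (Maybe; just; nothing)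
open import Data.Nat.Base as ℕ using (ℕ; zero; suc)
import Data.Nat.Properties as ℕ
open import Data.Product.Base using (Σ; ∃; ∃-syntax; _×_; _,_; proj₁; proj₂; map₁; map₂; uncurry)
open import Data.Product.Properties using (≡-dec)
open import Data.Sum.Base using (_⊎_; inj₁; inj₂)
open import Function.Base using (_∘_; _on_)
open import Function.Bundles using (_↔_)
open import Function.Properties.Inverse using (↔⇒↣)
open import Relation.Binary.Core using (Rel)
open import Relation.Binary.Definitions using (DecidableEquality; Decidable)
open import Relation.Binary.Construct.Closure.Equivalence as EqC using (EqClosure)
open import Relation.Binary.PropositionalEquality as ≡
  using (_≡_; _≢_; refl; cong; cong₂; subst)
open import Relation.Nullary using (Dec; yes; no; ¬_; ¬?; does)
import Relation.Nullary.Decidable as Dec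
import Relation.Unary as U


-- The apartness of a HeytingField is tight, and x # y holds exactly when x - y
-- is invertible; every classical field is one, with # the negation of ≈, and
-- 0# and 1# are automatically distinct.
fieldRing : ∀ {c ℓ₁ ℓ₂} → HeytingField c ℓ₁ ℓ₂ → CommutativeRing c ℓ₁
fieldRing 𝕜 = HeytingCommutativeRing.commutativeRing (HeytingField.heytingCommutativeRing 𝕜)

CharacteristicZero : ∀ {c ℓ} → CommutativeRing c ℓ → Set ℓ
CharacteristicZero R = ∀ n → ¬ ((suc n ×ₙ 1#) ≈ 0#)
  where
  open CommutativeRing R
  open RawMonoidDefs +-rawMonoid renaming (_×_ to _×ₙ_)


module Words {a} {A : Set a} (_≟_ : DecidableEquality A) where

  -- (a , i) is the variable x_{a,i+1}: positions are numbered from 0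
  -- instead of 1, which is harmless since only their order matters.
  Letter : Set a
  Letter = A × ℕ

  -- Monomials are words in the variables, considered up to _~_.
  Word : Set a
  Word = List Letter

  data _⇄_ : Rel Word a where
    swap : ∀ p {a b i j} s → i ≢ j →
           (p ++ (a , i) ∷ (b , j) ∷ s) ⇄ (p ++ (b , j) ∷ (a , i) ∷ s)

  infix 4 _~_
  _~_ : Rel Word a
  _~_ = EqClosure _⇄_

  ~-refl : ∀ {u} → u ~ u
  ~-refl = EqC.reflexive _⇄_

  ~-sym : ∀ {u v} → u ~ v → v ~ u
  ~-sym = EqC.symmetric _⇄_

  ~-trans : ∀ {u v w} → u ~ v → v ~ w → u ~ w
  ~-trans = EqC.transitive _⇄_

  ~-reflexive : ∀ {u v} → u ≡ v → u ~ v
  ~-reflexive refl = ~-refl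

  ~-invariant : ∀ {b} {B : Set b} (f : Word → B) →
                (∀ {u v} → u ⇄ v → f u ≡ f v) → ∀ {u v} → u ~ v → f u ≡ f v
  ~-invariant f = EqC.gfold ≡.isEquivalence f

  ∷-resp-~ : ∀ x {u v} → u ~ v → (x ∷ u) ~ (x ∷ v)
  ∷-resp-~ x = EqC.gmap (x ∷_) λ { (swap p s i≢j) → swap (x ∷ p) s i≢j }

  ++-respʳ-~ : ∀ p {u v} → u ~ v → (p ++ u) ~ (p ++ v)
  ++-respʳ-~ []      u~v = u~v
  ++-respʳ-~ (x ∷ p) u~v = ∷-resp-~ x (++-respʳ-~ p u~v)

  swap-head : ∀ {x y} s → proj₂ x ≢ proj₂ y → (x ∷ y ∷ s) ~ (y ∷ x ∷ s)
  swap-head s i≢j = EqC.return (swap [] s i≢j)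

  -- The subword of the letters in position i.
  π : ℕ → Word → List A
  π i []            = []
  π i ((a , j) ∷ u) with i ℕ.≟ j
  ... | yes _ = a ∷ π i u
  ... | no  _ = π i u

  π-hit : ∀ a i u → π i ((a , i) ∷ u) ≡ a ∷ π i u
  π-hit a i u with i ℕ.≟ i
  ... | yes _   = refl
  ... | no  i≢i = ⊥-elim (i≢i refl)

  π-miss : ∀ a {i j} u → i ≢ j → π i ((a , j) ∷ u) ≡ π i u
  π-miss a {i} {j} u i≢j with i ℕ.≟ j
  ... | yes i≡j = ⊥-elim (i≢j i≡j)
  ... | no  _   = refl

  π-++ : ∀ i u v → π i (u ++ v) ≡ π i u ++ π i v
  π-++ i []            v = refl
  π-++ i ((a , j) ∷ u) v with i ℕ.≟ j
  ... | yes _ = cong (a ∷_) (π-++ i u v)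
  ... | no  _ = π-++ i u v

  π-∷ : ∀ i x {u v} → π i u ≡ π i v → π i (x ∷ u) ≡ π i (x ∷ v)
  π-∷ i (a , j) eq with i ℕ.≟ j
  ... | yes _ = cong (a ∷_) eq
  ... | no  _ = eq

  π-∷⁻ : ∀ i x {u v} → π i (x ∷ u) ≡ π i (x ∷ v) → π i u ≡ π i v
  π-∷⁻ i (a , j) eq with i ℕ.≟ j
  ... | yes _ = List.∷-injectiveʳ eq
  ... | no  _ = eq

  π-⇄ : ∀ k {u v} → u ⇄ v → π k u ≡ π k v
  π-⇄ k (swap (x ∷ p) s i≢j) = π-∷ k x (π-⇄ k (swap p s i≢j))
  π-⇄ k (swap [] {a} {b} {i} {j} s i≢j) with k ℕ.≟ i
  ... | no  k≢i  = π-∷ k (b , j) (≡.sym (π-miss a s k≢i))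
  π-⇄ k (swap [] {a} {b} {i} {j} s i≢j)
    | yes refl = begin
      a ∷ π k ((b , j) ∷ s)       ≡⟨ cong (a ∷_) (π-miss b s i≢j) ⟩
      a ∷ π k s                   ≡⟨ π-hit a k s ⟨
      π k ((a , k) ∷ s)           ≡⟨ π-miss b ((a , k) ∷ s) i≢j ⟨
      π k ((b , j) ∷ (a , k) ∷ s) ∎
    where open ≡.≡-Reasoning

  π-resp-~ : ∀ k {u v} → u ~ v → π k u ≡ π k v
  π-resp-~ k = ~-invariant (π k) (π-⇄ k)

  pull : ∀ {a i r} v → π i v ≡ a ∷ r → ∃[ v′ ] (v ~ ((a , i) ∷ v′))
  pull {i = i} ((b , j) ∷ v) eq with i ℕ.≟ j
  pull {i = i} ((b , j) ∷ v) refl | yes refl = v , ~-refl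
  ... | no i≢j =
    let v′ , v~ = pull v eq
    in (b , j) ∷ v′ , ~-trans (∷-resp-~ (b , j) v~) (swap-head v′ (i≢j ∘ ≡.sym))

  π-empty : ∀ v → (∀ i → π i v ≡ []) → v ≡ []
  π-empty []            _  = refl
  π-empty ((a , i) ∷ v) eq with ≡.trans (≡.sym (π-hit a i v)) (eq i)
  ... | ()

  π-complete : ∀ u v → (∀ i → π i u ≡ π i v) → u ~ v
  π-complete []            v eq = ~-reflexive (≡.sym (π-empty v (≡.sym ∘ eq)))
  π-complete ((a , i) ∷ u) v eq =
    let v′ , v~ = pull v (≡.trans (≡.sym (eq i)) (π-hit a i u))
        eq′ = λ k → π-∷⁻ k (a , i) (≡.trans (eq k) (π-resp-~ k v~))
    in ~-trans (∷-resp-~ (a , i) (π-complete u v′ eq′)) (~-sym v~)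

  ∷-cancel-~ : ∀ x {u v} → (x ∷ u) ~ (x ∷ v) → u ~ v
  ∷-cancel-~ x {u} {v} eq = π-complete u v λ k → π-∷⁻ k x (π-resp-~ k eq)

  infix 4 _~?_
  _~?_ : Decidable _~_
  []            ~? []      = yes ~-refl
  []            ~? (y ∷ v) = no λ eq → nonempty (π-resp-~ (proj₂ y) eq)
    where
    nonempty : ¬ ([] ≡ π (proj₂ y) (y ∷ v))
    nonempty eq with ≡.trans eq (π-hit (proj₁ y) (proj₂ y) v)
    ... | ()
  ((a , i) ∷ u) ~? v with π i v in eq
  ... | []    = no λ u~v → case-empty (≡.trans (≡.sym (π-hit a i u)) (≡.trans (π-resp-~ i u~v) eq))
    where
    case-empty : ¬ (a ∷ π i u ≡ [])
    case-empty ()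
  ... | b ∷ r with a ≟ b
  ...   | no  a≢b  = no λ u~v → a≢b (List.∷-injectiveˡ
                       (≡.trans (≡.sym (π-hit a i u)) (≡.trans (π-resp-~ i u~v) eq)))
  ...   | yes refl with pull v eq
  ...     | v′ , v~ = Dec.map′
              (λ u~v′ → ~-trans (∷-resp-~ (a , i) u~v′) (~-sym v~))
              (λ u~v → ∷-cancel-~ (a , i) (~-trans u~v v~))
              (u ~? v′)

  length-~ : ∀ {u v} → u ~ v → length u ≡ length v
  length-~ = ~-invariant length λ { (swap p s _) → go p }
    where
    go : ∀ p {x y x′ y′ : Letter} {s : Word} →
         length (p ++ x ∷ y ∷ s) ≡ length (p ++ x′ ∷ y′ ∷ s)
    go []      = refl
    go (_ ∷ p) = cong suc (go p)

  -- Every position occurring in u is < bound u.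
  bound : Word → ℕ
  bound = foldr (λ x n → suc (proj₂ x) ℕ.⊔ n) 0

  bound-~ : ∀ {u v} → u ~ v → bound u ≡ bound v
  bound-~ = ~-invariant bound λ { (swap p s _) → go p s }
    where
    go : ∀ p {x y : Letter} s → bound (p ++ x ∷ y ∷ s) ≡ bound (p ++ y ∷ x ∷ s)
    go [] {_ , i} {_ , j} s = begin
      suc i ℕ.⊔ (suc j ℕ.⊔ bound s) ≡⟨ ℕ.⊔-assoc (suc i) (suc j) (bound s) ⟨
      (suc i ℕ.⊔ suc j) ℕ.⊔ bound s ≡⟨ cong (ℕ._⊔ bound s) (ℕ.⊔-comm (suc i) (suc j)) ⟩
      (suc j ℕ.⊔ suc i) ℕ.⊔ bound s ≡⟨ ℕ.⊔-assoc (suc j) (suc i) (bound s) ⟩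
      suc j ℕ.⊔ (suc i ℕ.⊔ bound s) ∎
      where open ≡.≡-Reasoning
    go (x ∷ p) s = cong (suc (proj₂ x) ℕ.⊔_) (go p s)

  π-bound : ∀ i u → π i u ≢ [] → i ℕ.< bound u
  π-bound i []            ne = ⊥-elim (ne refl)
  π-bound i ((a , j) ∷ u) ne with i ℕ.≟ j
  ... | yes refl = ℕ.m≤m⊔n (suc i) (bound u)
  ... | no  _    = ℕ.≤-trans (π-bound i u ne) (ℕ.m≤n⊔m (suc j) (bound u))

  infix 4 _⊥_ _⊥?_
  _⊥_ : ℕ → Word → Set a
  i ⊥ u = All (λ y → i ≢ proj₂ y) u

  _⊥?_ : Decidable _⊥_
  i ⊥? u = all? (λ y → ¬? (i ℕ.≟ proj₂ y)) u

  ⊥⇒π : ∀ {i} u → i ⊥ u → π i u ≡ []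
  ⊥⇒π []            []       = refl
  ⊥⇒π ((b , j) ∷ u) (ne ∷ p) = ≡.trans (π-miss b u ne) (⊥⇒π u p)

  π⇒⊥ : ∀ {i} u → π i u ≡ [] → i ⊥ u
  π⇒⊥     []            _  = []
  π⇒⊥ {i} ((b , j) ∷ u) eq with i ℕ.≟ j
  ... | no  i≢j = i≢j ∷ π⇒⊥ u eq
  π⇒⊥ {i} ((b , j) ∷ u) () | yes _

  ⊥-resp-~ : ∀ {i u v} → u ~ v → i ⊥ u → i ⊥ v
  ⊥-resp-~ {i} {u} {v} u~v i⊥u =
    π⇒⊥ v (≡.trans (≡.sym (π-resp-~ i u~v)) (⊥⇒π u i⊥u))

  -- One representative (u , v) for each factorisation w = u·v in the monoid
  -- of partially commutative monomials: the first letter of w either heads u,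
  -- or heads v and commutes with all of u.  See factorisations-sound,
  -- factorisations-complete and factorisations-distinct below.
  factorisations : Word → List (Word × Word)
  factorisations []      = [ ([] , []) ]
  factorisations (x ∷ w) =
    map (map₁ (x ∷_)) (factorisations w) ++
    map (map₂ (x ∷_)) (filter (λ uv → proj₂ x ⊥? proj₁ uv) (factorisations w))

  infix 4 _≈₂_
  _≈₂_ : Rel (Word × Word) a
  (u , v) ≈₂ (u′ , v′) = u ~ u′ × v ~ v′

  shift : ∀ {x} u {v} → proj₂ x ⊥ u → (u ++ x ∷ v) ~ (x ∷ u ++ v)
  shift []      []       = ~-refl
  shift (y ∷ u) (ne ∷ p) = ~-trans (∷-resp-~ y (shift u p)) (swap-head _ (ne ∘ ≡.sym))

  factorisations-sound : ∀ w → All (λ (u , v) → (u ++ v) ~ w) (factorisations w)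
  factorisations-sound []      = ~-refl ∷ []
  factorisations-sound (x ∷ w) = All.++⁺
    (All.map⁺ (All.map (∷-resp-~ x) (factorisations-sound w)))
    (All.map⁺ (All.zipWith (λ (x⊥u , uv~w) → ~-trans (shift _ x⊥u) (∷-resp-~ x uv~w))
      ( All.all-filter (λ uv → proj₂ x ⊥? proj₁ uv) (factorisations w)
      , All.filter⁺ (λ uv → proj₂ x ⊥? proj₁ uv) (factorisations-sound w))))

  ++-respˡ-~ : ∀ {u v} w → u ~ v → (u ++ w) ~ (v ++ w)
  ++-respˡ-~ {u} {v} w u~v = π-complete _ _ λ k →
    ≡.trans (π-++ k u w) (≡.trans (cong (_++ π k w) (π-resp-~ k u~v)) (≡.sym (π-++ k v w)))

  factorisations-complete : ∀ w u v → (u ++ v) ~ w → Any ((u , v) ≈₂_) (factorisations w)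
  factorisations-complete [] [] [] _ = here (~-refl , ~-refl)
  factorisations-complete [] [] (y ∷ v) eq with length-~ eq
  ... | ()
  factorisations-complete [] (x ∷ u) v eq with length-~ eq
  ... | ()
  factorisations-complete (x@(a , i) ∷ w) u v eq with π i u in πu
  ... | []    = Any.++⁺ʳ _ (Any.map⁺ (filter-any (factorisations-complete w u v′ eq′)))
    where
    x⊥u : i ⊥ u
    x⊥u = π⇒⊥ u πu
    πv : π i v ≡ a ∷ π i w
    πv = ≡.trans (cong (_++ π i v) (≡.sym πu))
        (≡.trans (≡.sym (π-++ i u v)) (≡.trans (π-resp-~ i eq) (π-hit a i w)))
    v′ = proj₁ (pull v πv)
    v~ = proj₂ (pull v πv)
    eq′ : (u ++ v′) ~ w
    eq′ = ∷-cancel-~ x (~-trans (~-sym (shift u x⊥u)) (~-trans (++-respʳ-~ u (~-sym v~)) eq))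
    P? = λ (uv : Word × Word) → i ⊥? proj₁ uv
    filter-any : ∀ {xs} → Any ((u , v′) ≈₂_) xs →
                 Any (λ (u₁ , v₁) → (u , v) ≈₂ (u₁ , x ∷ v₁)) (filter P? xs)
    filter-any {(u₁ , v₁) ∷ xs} p with i ⊥? u₁ | p
    ... | yes _   | here (p , q) = here (p , ~-trans v~ (∷-resp-~ x q))
    ... | yes _   | there p      = there (filter-any p)
    ... | no x⊥̸u | here (p , _) = ⊥-elim (x⊥̸u (⊥-resp-~ p x⊥u))
    ... | no _    | there p      = filter-any p
  ... | b ∷ r = Any.++⁺ˡ (Any.map⁺ (Any.map
      (λ (p , q) → ~-trans u~ (∷-resp-~ x p) , q)
      (factorisations-complete w u′ v eq′)))
    where
    πu′ : π i u ≡ a ∷ r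
    πu′ = ≡.trans πu (cong (_∷ r) (List.∷-injectiveˡ
      (≡.trans (cong (_++ π i v) (≡.sym πu))
      (≡.trans (≡.sym (π-++ i u v)) (≡.trans (π-resp-~ i eq) (π-hit a i w))))))
    u′ = proj₁ (pull u πu′)
    u~ = proj₂ (pull u πu′)
    eq′ : (u′ ++ v) ~ w
    eq′ = ∷-cancel-~ x (~-trans (++-respˡ-~ v (~-sym u~)) eq)

  factorisations-distinct : ∀ w → AllPairs (λ p q → ¬ (p ≈₂ q)) (factorisations w)
  factorisations-distinct []      = [] ∷ []
  factorisations-distinct (x@(a , i) ∷ w) = AllPairs.++⁺
    (AllPairs.map⁺ (AllPairs.map (λ ne (p , q) → ne (∷-cancel-~ x p , q)) ih))
    (AllPairs.map⁺ (AllPairs.map (λ ne (p , q) → ne (p , ∷-cancel-~ x q))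
      (AllPairs.filter⁺ P? ih)))
    (All.map⁺ (All.tabulate λ {(u , _)} _ → All.map⁺ (All.map
      (λ {(u₁ , _)} x⊥u₁ (p , _) → head-clash u (≡.trans (π-resp-~ i p) (⊥⇒π u₁ x⊥u₁)))
      (All.all-filter P? (factorisations w)))))
    where
    ih = factorisations-distinct w
    P? = λ (uv : Word × Word) → i ⊥? proj₁ uv
    head-clash : ∀ u → ¬ (π i (x ∷ u) ≡ [])
    head-clash u eq with ≡.trans (≡.sym (π-hit a i u)) eq
    ... | ()


module Sentences {a} {A : Set a} (_≟_ : DecidableEquality A) where

  open Words _≟_

  Sentence : Set a
  Sentence = List (List⁺ A)

  ∣_∣ : Sentence → ℕ
  ∣ I ∣ = length (concatMap toList I)

  _≟⁺_ : DecidableEquality (List⁺ A)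
  (a ∷ v) ≟⁺ (b ∷ w) = Dec.map′
    (λ { refl → refl }) (λ { refl → refl }) (List.≡-dec _≟_ (a ∷ v) (b ∷ w))

  infix 4 _≟ˢ_
  _≟ˢ_ : DecidableEquality Sentence
  _≟ˢ_ = List.≡-dec _≟⁺_

  tilde : List (List A) → Sentence
  tilde = mapMaybe fromList

  splittings : List A → List (List A × List A)
  splittings []      = [ ([] , []) ]
  splittings (a ∷ w) = ([] , a ∷ w) ∷ map (map₁ (a ∷_)) (splittings w)

  -- The pairs (I \ J , J), for J ⊂ I, before empty words are deleted.
  cuts : Sentence → List (List (List A) × List (List A))
  cuts []      = [ ([] , []) ]
  cuts (w ∷ I) = cartesianProductWith
    (λ (u , v) (us , vs) → u ∷ us , v ∷ vs) (splittings (toList w)) (cuts I)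

  cutSentences : Sentence → List (Sentence × Sentence)
  cutSentences I = map (λ (us , vs) → tilde us , tilde vs) (cuts I)

  letters : List (List A) → ℕ
  letters ws = length (concat ws)

  ∣tilde∣ : ∀ ws → ∣ tilde ws ∣ ≡ letters ws
  ∣tilde∣ []             = refl
  ∣tilde∣ ([] ∷ ws)      = ∣tilde∣ ws
  ∣tilde∣ ((a ∷ w) ∷ ws) = begin
    suc (length (w ++ concat (map toList (tilde ws)))) ≡⟨ cong suc (List.length-++ w) ⟩
    suc (length w ℕ.+ ∣ tilde ws ∣)                    ≡⟨ cong (λ n → suc (length w ℕ.+ n)) (∣tilde∣ ws) ⟩
    suc (length w ℕ.+ letters ws)                      ≡⟨ cong suc (List.length-++ w) ⟨
    suc (length (w ++ concat ws))                      ∎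
    where open ≡.≡-Reasoning

  splittings-sound : ∀ w → All (λ (u , v) → u ++ v ≡ w) (splittings w)
  splittings-sound []      = refl ∷ []
  splittings-sound (a ∷ w) = refl ∷ All.map⁺ (All.map (cong (a ∷_)) (splittings-sound w))

  cuts-size : ∀ I → All (λ (us , vs) → letters us ℕ.+ letters vs ≡ ∣ I ∣) (cuts I)
  cuts-size []      = refl ∷ []
  cuts-size (w ∷ I) = go (splittings-sound (toList w))
    where
    open ≡.≡-Reasoning
    combine : ∀ u v us vs → u ++ v ≡ toList w → letters us ℕ.+ letters vs ≡ ∣ I ∣ →
              letters (u ∷ us) ℕ.+ letters (v ∷ vs) ≡ ∣ w ∷ I ∣
    combine u v us vs uv≡w eq = begin
      length (u ++ concat us) ℕ.+ length (v ++ concat vs)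
        ≡⟨ cong₂ ℕ._+_ (List.length-++ u) (List.length-++ v) ⟩
      (length u ℕ.+ letters us) ℕ.+ (length v ℕ.+ letters vs)
        ≡⟨ CommutativeSemigroupProperties.interchange ℕ.+-commutativeSemigroup
             (length u) (letters us) (length v) (letters vs) ⟩
      (length u ℕ.+ length v) ℕ.+ (letters us ℕ.+ letters vs)
        ≡⟨ cong₂ ℕ._+_ (≡.sym (List.length-++ u)) eq ⟩
      length (u ++ v) ℕ.+ ∣ I ∣
        ≡⟨ cong (λ l → length l ℕ.+ ∣ I ∣) uv≡w ⟩
      length (toList w) ℕ.+ ∣ I ∣
        ≡⟨ List.length-++ (toList w) ⟨
      ∣ w ∷ I ∣ ∎
    go : ∀ {xs} → All (λ (u , v) → u ++ v ≡ toList w) xs →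
         All (λ (us , vs) → letters us ℕ.+ letters vs ≡ ∣ w ∷ I ∣)
             (cartesianProductWith (λ (u , v) (us , vs) → u ∷ us , v ∷ vs) xs (cuts I))
    go []                        = []
    go (_∷_ {x = u , v} eq eqs) = All.++⁺
      (All.map⁺ (All.map (λ {(us , vs)} → combine u v us vs eq) (cuts-size I))) (go eqs)

  cutSentences-size : ∀ I → All (λ (P , Q) → ∣ P ∣ ℕ.+ ∣ Q ∣ ≡ ∣ I ∣) (cutSentences I)
  cutSentences-size I = All.map⁺ (All.map
    (λ {(us , vs)} eq → ≡.trans (cong₂ ℕ._+_ (∣tilde∣ us) (∣tilde∣ vs)) eq) (cuts-size I))

  -- x_{w₁,j₁} x_{w₂,j₂} ⋯ x_{wₘ,jₘ}
  monomial : Sentence → List ℕ → Word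
  monomial I js = concat (zipWith (λ w j → map (_, j) (toList w)) I js)

  tuples : ∀ {x} {X : Set x} → ℕ → List X → List (List X)
  tuples zero    xs = [ [] ]
  tuples (suc m) xs = cartesianProductWith _∷_ xs (tuples m xs)

  increasing : ℕ → ℕ → List (List ℕ)
  increasing m N = filter (linked? ℕ._<?_) (tuples m (upTo N))

  tuples-length : ∀ {x} {X : Set x} m (xs : List X) → All (λ js → length js ≡ m) (tuples m xs)
  tuples-length zero    xs = refl ∷ []
  tuples-length (suc m) xs = go xs
    where
    go : ∀ ys → All (λ js → length js ≡ suc m) (cartesianProductWith _∷_ ys (tuples m xs))
    go []       = []
    go (y ∷ ys) = All.++⁺ (All.map⁺ (All.map (cong suc) (tuples-length m xs))) (go ys)

  length-monomial : ∀ I js → length js ≡ length I → length (monomial I js) ≡ ∣ I ∣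
  length-monomial []      []       _  = refl
  length-monomial (w ∷ I) (j ∷ js) eq = begin
    length (map (_, j) (toList w) ++ monomial I js)
      ≡⟨ List.length-++ (map (_, j) (toList w)) ⟩
    length (map (_, j) (toList w)) ℕ.+ length (monomial I js)
      ≡⟨ cong₂ ℕ._+_ (List.length-map (_, j) (toList w)) (length-monomial I js (ℕ.suc-injective eq)) ⟩
    length (toList w) ℕ.+ ∣ I ∣
      ≡⟨ List.length-++ (toList w) ⟨
    ∣ w ∷ I ∣ ∎
    where open ≡.≡-Reasoning

  -- Positions ≥ bound u can be ignored when looking for the tuples js whose
  -- monomial is u.
  monomial-bound : ∀ I js {u} → length js ≡ length I → monomial I js ~ u →
                   All (ℕ._< bound u) js
  monomial-bound I js eq m~u =
    subst (λ n → All (ℕ._< n) js) (bound-~ m~u) (go I js eq)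
    where
    bound-++ʳ : ∀ p {n} u → n ℕ.< bound u → n ℕ.< bound (p ++ u)
    bound-++ʳ []      u lt = lt
    bound-++ʳ (x ∷ p) u lt = ℕ.≤-trans (bound-++ʳ p u lt) (ℕ.m≤n⊔m (suc (proj₂ x)) (bound (p ++ u)))
    go : ∀ I js → length js ≡ length I → All (ℕ._< bound (monomial I js)) js
    go []            []       _  = []
    go ((a ∷ w) ∷ I) (j ∷ js) eq =
      ℕ.m≤m⊔n (suc j) (bound (map (_, j) w ++ monomial I js)) ∷
      All.map (bound-++ʳ (map (_, j) (a ∷ w)) (monomial I js)) (go I js (ℕ.suc-injective eq))


-- As with the Raw bundles of the library, only the operations are recorded.
record RawAlgebra {k} (K : Set k) m ℓ : Set (k ⊔ lsuc (m ⊔ ℓ)) where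
  infix  4 _≈_
  infixl 6 _+_
  infixl 7 _*_
  infixr 7 _·_
  infix  8 -_
  field
    Carrier : Set m
    _≈_     : Rel Carrier ℓ
    _+_     : Op₂ Carrier
    _*_     : Op₂ Carrier
    _·_     : Opₗ K Carrier
    -_      : Op₁ Carrier
    0#      : Carrier
    1#      : Carrier

  rawRing : RawRing m ℓ
  rawRing = record
    { _≈_ = _≈_ ; _+_ = _+_ ; _*_ = _*_ ; -_ = -_ ; 0# = 0# ; 1# = 1# }

  rawLeftModule : RawLeftModule K m ℓ
  rawLeftModule = record
    { _≈ᴹ_ = _≈_ ; _+ᴹ_ = _+_ ; _*ₗ_ = _·_ ; 0ᴹ = 0# ; -ᴹ_ = -_ }

  linearCombination : ∀ {x} {X : Set x} → (X → Carrier) → List (K × X) → Carrier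
  linearCombination b = foldr (λ (c , x) s → c · b x + s) 0#

  Span : ∀ {x} {X : Set x} → (X → Carrier) → Carrier → Set (k ⊔ ℓ ⊔ x)
  Span b f = ∃[ cs ] f ≈ linearCombination b cs

  record IsSubalgebra {p} (P : Carrier → Set p) : Set (k ⊔ m ⊔ ℓ ⊔ p) where
    field
      resp     : ∀ {f g} → f ≈ g → P f → P g
      +-closed : ∀ {f g} → P f → P g → P (f + g)
      ·-closed : ∀ c {f} → P f → P (c · f)
      neg-closed : ∀ {f} → P f → P (- f)
      0-closed : P 0#
      *-closed : ∀ {f g} → P f → P g → P (f * g)
      1-closed : P 1#

  subalgebra : ∀ {p} {P : Carrier → Set p} → IsSubalgebra P → RawAlgebra K (m ⊔ p) ℓ
  subalgebra {P = P} sub = record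
    { Carrier = Σ Carrier P
    ; _≈_     = _≈_ on proj₁
    ; _+_     = λ (f , p) (g , q) → f + g , +-closed p q
    ; _*_     = λ (f , p) (g , q) → f * g , *-closed p q
    ; _·_     = λ c (f , p) → c · f , ·-closed c p
    ; -_      = λ (f , p) → - f , neg-closed p
    ; 0#      = 0# , 0-closed
    ; 1#      = 1# , 1-closed
    } where open IsSubalgebra sub

module _ {k} {K : Set k} {m₁ ℓ₁ m₂ ℓ₂} (𝐀 : RawAlgebra K m₁ ℓ₁) (𝐁 : RawAlgebra K m₂ ℓ₂) where
  private
    module 𝐀 = RawAlgebra 𝐀
    module 𝐁 = RawAlgebra 𝐁

  record IsAlgebraIsomorphism (φ : 𝐀.Carrier → 𝐁.Carrier) : Set (k ⊔ m₁ ⊔ ℓ₁ ⊔ m₂ ⊔ ℓ₂) where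
    field
      isRingIsomorphism       : RingMorphisms.IsRingIsomorphism 𝐀.rawRing 𝐁.rawRing φ
      isLeftModuleIsomorphism :
        LeftModuleMorphisms.IsLeftModuleIsomorphism 𝐀.rawLeftModule 𝐁.rawLeftModule φ


module Sums {c ℓ} (R : CommutativeRing c ℓ) where

  open CommutativeRing R hiding (_-_) renaming (Carrier to K; refl to ≈-refl; sym to ≈-sym; trans to ≈-trans; reflexive to ≈-reflexive)
  open import Relation.Binary.Reasoning.Setoid setoid
  open CommutativeSemigroupProperties (CommutativeRing.+-commutativeSemigroup R)
    using () renaming (interchange to +-interchange)
  open CommutativeSemigroupProperties (CommutativeRing.*-commutativeSemigroup R)
    using (x∙yz≈y∙xz)

  ⟦_⟧ : ∀ {p} {P : Set p} → Dec P → K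
  ⟦ d ⟧ = if does d then 1# else 0#

  ⟦⟧-cong : ∀ {p q} {P : Set p} {Q : Set q} → (P → Q) → (Q → P) →
            (d : Dec P) (e : Dec Q) → ⟦ d ⟧ ≡ ⟦ e ⟧
  ⟦⟧-cong f g (yes _) (yes _) = refl
  ⟦⟧-cong f g (yes p) (no ¬q) = ⊥-elim (¬q (f p))
  ⟦⟧-cong f g (no ¬p) (yes q) = ⊥-elim (¬p (g q))
  ⟦⟧-cong f g (no _)  (no _)  = refl

  ⟦⟧-no : ∀ {p} {P : Set p} (d : Dec P) → ¬ P → ⟦ d ⟧ ≡ 0#
  ⟦⟧-no (yes p) ¬p = ⊥-elim (¬p p)
  ⟦⟧-no (no _)  _  = refl

  ⟦⟧-yes : ∀ {p} {P : Set p} (d : Dec P) → P → ⟦ d ⟧ ≡ 1#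
  ⟦⟧-yes (yes _) _ = refl
  ⟦⟧-yes (no ¬p) p = ⊥-elim (¬p p)

  module _ {x} {X : Set x} where

    ∑ : List X → (X → K) → K
    ∑ xs f = foldr (λ x s → f x + s) 0# xs

    ∑-cong-All : ∀ {f g} {xs} → All (λ x → f x ≈ g x) xs → ∑ xs f ≈ ∑ xs g
    ∑-cong-All []         = ≈-refl
    ∑-cong-All (eq ∷ eqs) = +-cong eq (∑-cong-All eqs)

    ∑-cong : ∀ {f g} xs → (∀ x → f x ≈ g x) → ∑ xs f ≈ ∑ xs g
    ∑-cong xs eq = ∑-cong-All (All.universal eq xs)

    ∑-zero : ∀ {f} {xs} → All (λ x → f x ≈ 0#) xs → ∑ xs f ≈ 0#
    ∑-zero []         = ≈-refl
    ∑-zero (eq ∷ eqs) = ≈-trans (+-cong eq (∑-zero eqs)) (+-identityˡ 0#)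

    ∑-++ : ∀ f xs ys → ∑ (xs ++ ys) f ≈ ∑ xs f + ∑ ys f
    ∑-++ f []       ys = ≈-sym (+-identityˡ _)
    ∑-++ f (x ∷ xs) ys = ≈-trans (+-congˡ (∑-++ f xs ys)) (≈-sym (+-assoc _ _ _))

    ∑-+ : ∀ f g xs → ∑ xs (λ x → f x + g x) ≈ ∑ xs f + ∑ xs g
    ∑-+ f g []       = ≈-sym (+-identityˡ 0#)
    ∑-+ f g (x ∷ xs) = ≈-trans (+-congˡ (∑-+ f g xs)) (+-interchange _ _ _ _)

    ∑-* : ∀ k f xs → ∑ xs (λ x → k * f x) ≈ k * ∑ xs f
    ∑-* k f []       = ≈-sym (zeroʳ k)
    ∑-* k f (x ∷ xs) = ≈-trans (+-congˡ (∑-* k f xs)) (≈-sym (distribˡ k _ _))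

    ∑-filter : ∀ {p} {P : X → Set p} (P? : U.Decidable P) f xs →
               ∑ (filter P? xs) f ≈ ∑ xs (λ x → ⟦ P? x ⟧ * f x)
    ∑-filter P? f []       = ≈-refl
    ∑-filter P? f (x ∷ xs) with does (P? x)
    ... | true  = +-cong (≈-sym (*-identityˡ _)) (∑-filter P? f xs)
    ... | false = ≈-trans (∑-filter P? f xs) (≈-sym (≈-trans (+-congʳ (zeroˡ _)) (+-identityˡ _)))

  ∑-map : ∀ {x y} {X : Set x} {Y : Set y} (h : X → Y) f xs → ∑ (map h xs) f ≈ ∑ xs (f ∘ h)
  ∑-map h f []       = ≈-refl
  ∑-map h f (x ∷ xs) = +-congˡ (∑-map h f xs)

  ∑-swap : ∀ {x y} {X : Set x} {Y : Set y} (f : X → Y → K) xs ys →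
           ∑ xs (λ x → ∑ ys (f x)) ≈ ∑ ys (λ y → ∑ xs (λ x → f x y))
  ∑-swap f []       ys = ≈-sym (∑-zero (All.universal (λ _ → ≈-refl) ys))
  ∑-swap f (x ∷ xs) ys = ≈-trans (+-congˡ (∑-swap f xs ys)) (≈-sym (∑-+ _ _ ys))

  ∑-δ : ∀ {x} {X : Set x} (_≟_ : DecidableEquality X) (f : X → K) {x xs} →
        Unique xs → x ∈ xs → ∑ xs (λ y → ⟦ x ≟ y ⟧ * f y) ≈ f x
  ∑-δ _≟_ f {x} {_ ∷ xs} (x∉ ∷ u) (here refl) = begin
    ⟦ x ≟ x ⟧ * f x + ∑ xs (λ y → ⟦ x ≟ y ⟧ * f y)
      ≈⟨ +-cong (*-congʳ (≈-reflexive (⟦⟧-yes (x ≟ x) refl)))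
                (∑-zero (All.map (λ ne → ≈-trans (*-congʳ (≈-reflexive (⟦⟧-no (x ≟ _) ne))) (zeroˡ _)) x∉)) ⟩
    1# * f x + 0#  ≈⟨ +-identityʳ _ ⟩
    1# * f x       ≈⟨ *-identityˡ _ ⟩
    f x            ∎
  ∑-δ _≟_ f {x} {y ∷ xs} (y∉ ∷ u) (there x∈) = begin
    ⟦ x ≟ y ⟧ * f y + ∑ xs (λ y → ⟦ x ≟ y ⟧ * f y)
      ≈⟨ +-cong (*-congʳ (≈-reflexive (⟦⟧-no (x ≟ y) (λ { refl → All.lookup y∉ x∈ refl }))))
                (∑-δ _≟_ f u x∈) ⟩
    0# * f y + f x ≈⟨ +-congʳ (zeroˡ _) ⟩
    0# + f x       ≈⟨ +-identityˡ _ ⟩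
    f x            ∎

  mixed-interchange : ∀ α β p q r s →
    (p + α * q) + β * (r + α * s) ≈ (p + β * r) + α * (q + β * s)
  mixed-interchange α β p q r s = begin
    (p + α * q) + β * (r + α * s)         ≈⟨ +-congˡ (distribˡ β r (α * s)) ⟩
    (p + α * q) + (β * r + β * (α * s))   ≈⟨ +-interchange _ _ _ _ ⟩
    (p + β * r) + (α * q + β * (α * s))   ≈⟨ +-congˡ (+-congˡ (x∙yz≈y∙xz β α s)) ⟩
    (p + β * r) + (α * q + α * (β * s))   ≈⟨ +-congˡ (distribˡ α q (β * s)) ⟨
    (p + β * r) + α * (q + β * s)         ∎


-- Finite formal linear combinations of elements of X, compared coefficientwise.
module FreeModule {c ℓ x} (R : CommutativeRing c ℓ) {X : Set x} (_≟_ : DecidableEquality X) where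

  open CommutativeRing R hiding (_-_) renaming (Carrier to K; refl to ≈-refl; sym to ≈-sym; trans to ≈-trans; reflexive to ≈-reflexive)
  open import Relation.Binary.Reasoning.Setoid setoid
  open Sums R

  Free : Set (c ⊔ x)
  Free = List (K × X)

  extend : (X → K) → Free → K
  extend φ h = ∑ h (λ (k , x) → k * φ x)

  coeff : Free → X → K
  coeff h y = extend (λ x → ⟦ x ≟ y ⟧) h

  infix 4 _≋_
  _≋_ : Rel Free (x ⊔ ℓ)
  h ≋ h′ = ∀ y → coeff h y ≈ coeff h′ y

  infixr 7 _·ᶠ_
  _·ᶠ_ : K → Free → Free
  k ·ᶠ h = map (map₁ (k *_)) h

  basis : X → Free
  basis x = [ (1# , x) ]

  rawFreeModule : RawLeftModule K (c ⊔ x) (x ⊔ ℓ)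
  rawFreeModule = record
    { _≈ᴹ_ = _≋_ ; _+ᴹ_ = _++_ ; _*ₗ_ = _·ᶠ_ ; 0ᴹ = [] ; -ᴹ_ = map (map₁ -_) }

  IsLinear : (Free → K) → Set (c ⊔ x ⊔ ℓ)
  IsLinear = LeftModuleMorphisms.IsLeftModuleHomomorphism
    rawFreeModule (TensorUnit.rawLeftModule {R = CommutativeRing.rawRing R})

  extend-++ : ∀ φ h h′ → extend φ (h ++ h′) ≈ extend φ h + extend φ h′
  extend-++ φ = ∑-++ _

  extend-· : ∀ φ k h → extend φ (k ·ᶠ h) ≈ k * extend φ h
  extend-· φ k h = begin
    extend φ (k ·ᶠ h)                   ≈⟨ ∑-map _ _ h ⟩
    ∑ h (λ (l , x) → (k * l) * φ x)     ≈⟨ ∑-cong h (λ _ → *-assoc _ _ _) ⟩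
    ∑ h (λ (l , x) → k * (l * φ x))     ≈⟨ ∑-* k _ h ⟩
    k * extend φ h                      ∎

  extend-neg : ∀ φ h → extend φ (map (map₁ -_) h) + extend φ h ≈ 0#
  extend-neg φ h = begin
    extend φ (map (map₁ -_) h) + extend φ h           ≈⟨ +-congʳ (∑-map _ _ h) ⟩
    ∑ h (λ (l , x) → (- l) * φ x) + extend φ h        ≈⟨ ∑-+ _ _ h ⟨
    ∑ h (λ (l , x) → (- l) * φ x + l * φ x)           ≈⟨ ∑-zero (All.universal (λ (l , x) →
       ≈-trans (≈-sym (distribʳ _ _ _)) (≈-trans (*-congʳ (-‿inverseˡ l)) (zeroˡ _))) h) ⟩
    0# ∎

  extend-basis : ∀ φ x → extend φ (basis x) ≈ φ x
  extend-basis φ x = ≈-trans (+-identityʳ _) (*-identityˡ _)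

  extend-coeff : ∀ φ h ys → Unique ys → All (λ (_ , x) → x ∈ ys) h →
                 extend φ h ≈ ∑ ys (λ y → coeff h y * φ y)
  extend-coeff φ h ys u h⊆ys = begin
    ∑ h (λ (k , x) → k * φ x)
      ≈⟨ ∑-cong-All (All.map (λ x∈ → *-congˡ (≈-sym (∑-δ _≟_ φ u x∈))) h⊆ys) ⟩
    ∑ h (λ (k , x) → k * ∑ ys (λ y → ⟦ x ≟ y ⟧ * φ y))
      ≈⟨ ∑-cong h (λ (k , x) → ≈-sym (∑-* k _ ys)) ⟩
    ∑ h (λ (k , x) → ∑ ys (λ y → k * (⟦ x ≟ y ⟧ * φ y)))
      ≈⟨ ∑-swap _ h ys ⟩
    ∑ ys (λ y → ∑ h (λ (k , x) → k * (⟦ x ≟ y ⟧ * φ y)))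
      ≈⟨ ∑-cong ys (λ y → ∑-cong h (λ (k , x) →
           ≈-trans (≈-sym (*-assoc _ _ _)) (*-comm _ (φ y)))) ⟩
    ∑ ys (λ y → ∑ h (λ (k , x) → φ y * (k * ⟦ x ≟ y ⟧)))
      ≈⟨ ∑-cong ys (λ y → ≈-trans (∑-* (φ y) _ h) (*-comm _ _)) ⟩
    ∑ ys (λ y → coeff h y * φ y) ∎

  support : Free → List X
  support h = deduplicate _≟_ (map proj₂ h)

  support-unique : ∀ h → Unique (support h)
  support-unique h = Unique.deduplicate-! _≟_ (map proj₂ h)

  support-covers : ∀ h → All (λ (_ , x) → x ∈ support h) h
  support-covers h = All.tabulate λ p → ∈-deduplicate⁺ _≟_ (∈-map⁺ proj₂ p)

  extend-cong : ∀ φ {h h′} → h ≋ h′ → extend φ h ≈ extend φ h′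
  extend-cong φ {h} {h′} eq = begin
    extend φ h                     ≈⟨ extend-coeff φ h ys unique (All.++⁻ˡ h covers) ⟩
    ∑ ys (λ y → coeff h y * φ y)   ≈⟨ ∑-cong ys (λ y → *-congʳ (eq y)) ⟩
    ∑ ys (λ y → coeff h′ y * φ y)  ≈⟨ extend-coeff φ h′ ys unique (All.++⁻ʳ h covers) ⟨
    extend φ h′                    ∎
    where
    ys     = support (h ++ h′)
    unique = support-unique (h ++ h′)
    covers = support-covers (h ++ h′)

  extend-vanish : ∀ φ h → (∀ y → coeff h y * φ y ≈ 0#) → extend φ h ≈ 0#
  extend-vanish φ h eq = ≈-trans
    (extend-coeff φ h (support h) (support-unique h) (support-covers h))
    (∑-zero (All.universal eq (support h)))

  isLinear : ∀ f → (∀ {h h′} → h ≋ h′ → f h ≈ f h′) →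
             (∀ h h′ → f (h ++ h′) ≈ f h + f h′) → (∀ k h → f (k ·ᶠ h) ≈ k * f h) →
             IsLinear f
  isLinear f f-cong f-+ f-· = record
    { +ᴹ-isGroupHomomorphism = record
      { isMonoidHomomorphism = record
        { isMagmaHomomorphism = record
          { isRelHomomorphism = record { cong = f-cong }
          ; homo              = f-+
          }
        ; ε-homo = f-0
        }
      ; ⁻¹-homo = λ h → inverseˡ-unique _ _ (begin
          f (map (map₁ -_) h) + f h  ≈⟨ f-+ _ h ⟨
          f (map (map₁ -_) h ++ h)   ≈⟨ f-cong (λ y → ≈-trans (extend-++ _ (map (map₁ -_) h) h) (extend-neg _ h)) ⟩
          f []                       ≈⟨ f-0 ⟩
          0#                         ∎)
      }
    ; *ₗ-homo = f-·
    }
    where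
    open RingProperties (CommutativeRing.ring R) using () renaming (+-inverseˡ-unique to inverseˡ-unique)
    f-0 : f [] ≈ 0#
    f-0 = ≈-trans (f-· 0# []) (zeroˡ _)

  extend-isLinear : ∀ φ → IsLinear (extend φ)
  extend-isLinear φ = isLinear (extend φ) (λ {h} {h′} → extend-cong φ {h} {h′}) (extend-++ φ) (extend-· φ)


module Setup {c ℓ a} (R : CommutativeRing c ℓ) {A : Set a} {n : ℕ} (finite : A ↔ Fin n) where

  open CommutativeRing R hiding (_-_) renaming (Carrier to K; refl to ≈-refl; sym to ≈-sym; trans to ≈-trans; reflexive to ≈-reflexive)
  open import Relation.Binary.Reasoning.Setoid setoid
  open RingProperties (CommutativeRing.ring R) using (-0#≈0#; -‿+-comm; -‿distribʳ-*)
  open CommutativeSemigroupProperties (CommutativeRing.+-commutativeSemigroup R)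
    using () renaming (interchange to +-interchange)
  open CommutativeSemigroupProperties (CommutativeRing.*-commutativeSemigroup R)
    using (x∙yz≈y∙xz)

  _≟ᴬ_ : DecidableEquality A
  _≟ᴬ_ = inj⇒≟ (↔⇒↣ finite)

  open Words _≟ᴬ_ public
  open Sentences _≟ᴬ_ public
  open Sums R public

  ∑ꟳ : Word → (Word → Word → K) → K
  ∑ꟳ w F = ∑ (factorisations w) (λ (u , v) → F u v)

  ∑ꟳ-cong : ∀ w {F G} → (∀ u v → F u v ≈ G u v) → ∑ꟳ w F ≈ ∑ꟳ w G
  ∑ꟳ-cong w eq = ∑-cong (factorisations w) (λ (u , v) → eq u v)

  ∑ꟳ-∷ : ∀ x w F →
    ∑ꟳ (x ∷ w) F ≈ ∑ꟳ w (λ u v → F (x ∷ u) v + ⟦ proj₂ x ⊥? u ⟧ * F u (x ∷ v))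
  ∑ꟳ-∷ x w F = begin
    ∑ꟳ (x ∷ w) F
      ≈⟨ ∑-++ F′ (map (map₁ (x ∷_)) fs) (map (map₂ (x ∷_)) (filter P? fs)) ⟩
    ∑ (map (map₁ (x ∷_)) fs) F′ + ∑ (map (map₂ (x ∷_)) (filter P? fs)) F′
      ≈⟨ +-cong (∑-map (map₁ (x ∷_)) F′ fs) (∑-map (map₂ (x ∷_)) F′ (filter P? fs)) ⟩
    ∑ fs (λ (u , v) → F (x ∷ u) v) + ∑ (filter P? fs) (λ (u , v) → F u (x ∷ v))
      ≈⟨ +-congˡ (∑-filter P? _ fs) ⟩
    ∑ fs (λ (u , v) → F (x ∷ u) v) + ∑ fs (λ (u , v) → ⟦ proj₂ x ⊥? u ⟧ * F u (x ∷ v))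
      ≈⟨ ∑-+ _ _ fs ⟨
    ∑ꟳ w (λ u v → F (x ∷ u) v + ⟦ proj₂ x ⊥? u ⟧ * F u (x ∷ v)) ∎
    where
    fs = factorisations w
    P? = λ (uv : Word × Word) → proj₂ x ⊥? proj₁ uv
    F′ = λ (uv : Word × Word) → F (proj₁ uv) (proj₂ uv)

  Respects : (Word → Word → K) → Set (a ⊔ ℓ)
  Respects F = ∀ {u u′ v v′} → u ~ u′ → v ~ v′ → F u v ≈ F u′ v′

  ⟦⊥⟧-~ : ∀ i {u u′} → u ~ u′ → ⟦ i ⊥? u ⟧ ≡ ⟦ i ⊥? u′ ⟧
  ⟦⊥⟧-~ i {u} {u′} u~u′ = ⟦⟧-cong (⊥-resp-~ u~u′) (⊥-resp-~ (~-sym u~u′)) (i ⊥? u) (i ⊥? u′)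

  ⟦⊥⟧-∷ : ∀ {i} x u → i ≢ proj₂ x → ⟦ i ⊥? (x ∷ u) ⟧ ≡ ⟦ i ⊥? u ⟧
  ⟦⊥⟧-∷ {i} x u ne = ⟦⟧-cong All.tail (ne ∷_) (i ⊥? (x ∷ u)) (i ⊥? u)

  step : Letter → (Word → Word → K) → Word → Word → K
  step x F u v = F (x ∷ u) v + ⟦ proj₂ x ⊥? u ⟧ * F u (x ∷ v)

  step-respects : ∀ x {F} → Respects F → Respects (step x F)
  step-respects x F-resp p q = +-cong (F-resp (∷-resp-~ x p) q)
    (*-cong (≈-reflexive (⟦⊥⟧-~ (proj₂ x) p)) (F-resp p (∷-resp-~ x q)))

  step-swap : ∀ x y {F} → Respects F → proj₂ x ≢ proj₂ y → ∀ u v →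
              step y (step x F) u v ≈ step x (step y F) u v
  step-swap x y {F} F-resp ne u v = begin
    step y (step x F) u v
      ≈⟨ +-congʳ (+-congˡ (*-congʳ (≈-reflexive (⟦⊥⟧-∷ y u ne)))) ⟩
    (F (x ∷ y ∷ u) v + ⟦ proj₂ x ⊥? u ⟧ * F (y ∷ u) (x ∷ v))
      + ⟦ proj₂ y ⊥? u ⟧ * (F (x ∷ u) (y ∷ v) + ⟦ proj₂ x ⊥? u ⟧ * F u (x ∷ y ∷ v))
      ≈⟨ mixed-interchange _ _ _ _ _ _ ⟩
    (F (x ∷ y ∷ u) v + ⟦ proj₂ y ⊥? u ⟧ * F (x ∷ u) (y ∷ v))
      + ⟦ proj₂ x ⊥? u ⟧ * (F (y ∷ u) (x ∷ v) + ⟦ proj₂ y ⊥? u ⟧ * F u (x ∷ y ∷ v))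
      ≈⟨ +-cong (+-cong (F-resp (swap-head u ne) ~-refl)
                        (*-congʳ (≈-reflexive (≡.sym (⟦⊥⟧-∷ x u (ne ∘ ≡.sym))))))
                (*-congˡ (+-congˡ (*-congˡ (F-resp ~-refl (swap-head v ne))))) ⟩
    step x (step y F) u v ∎

  ∑ꟳ-swap : ∀ p {x y} s → proj₂ x ≢ proj₂ y → ∀ F → Respects F →
            ∑ꟳ (p ++ x ∷ y ∷ s) F ≈ ∑ꟳ (p ++ y ∷ x ∷ s) F
  ∑ꟳ-swap [] {x} {y} s ne F F-resp = begin
    ∑ꟳ (x ∷ y ∷ s) F            ≈⟨ ∑ꟳ-∷ x (y ∷ s) F ⟩
    ∑ꟳ (y ∷ s) (step x F)       ≈⟨ ∑ꟳ-∷ y s (step x F) ⟩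
    ∑ꟳ s (step y (step x F))    ≈⟨ ∑ꟳ-cong s (step-swap x y F-resp ne) ⟩
    ∑ꟳ s (step x (step y F))    ≈⟨ ∑ꟳ-∷ x s (step y F) ⟨
    ∑ꟳ (x ∷ s) (step y F)       ≈⟨ ∑ꟳ-∷ y (x ∷ s) F ⟨
    ∑ꟳ (y ∷ x ∷ s) F            ∎
  ∑ꟳ-swap (z ∷ p) {x} {y} s ne F F-resp = begin
    ∑ꟳ (z ∷ p ++ x ∷ y ∷ s) F         ≈⟨ ∑ꟳ-∷ z (p ++ x ∷ y ∷ s) F ⟩
    ∑ꟳ (p ++ x ∷ y ∷ s) (step z F)    ≈⟨ ∑ꟳ-swap p s ne (step z F) (step-respects z F-resp) ⟩
    ∑ꟳ (p ++ y ∷ x ∷ s) (step z F)    ≈⟨ ∑ꟳ-∷ z (p ++ y ∷ x ∷ s) F ⟨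
    ∑ꟳ (z ∷ p ++ y ∷ x ∷ s) F         ∎

  ∑ꟳ-resp-~ : ∀ F → Respects F → ∀ {w w′} → w ~ w′ → ∑ꟳ w F ≈ ∑ꟳ w′ F
  ∑ꟳ-resp-~ F F-resp = EqC.gfold isEquivalence (λ w → ∑ꟳ w F)
    λ { (swap p s ne) → ∑ꟳ-swap p s ne F F-resp }

  exceeds : ∀ d e m k → d ℕ.+ e ℕ.< m ℕ.+ k → (d ℕ.< m) ⊎ (e ℕ.< k)
  exceeds d e m k lt with d ℕ.<? m | e ℕ.<? k
  ... | yes p | _     = inj₁ p
  ... | no  _ | yes q = inj₂ q
  ... | no ¬p | no ¬q = ⊥-elim (ℕ.<⇒≱ lt (ℕ.+-mono-≤ (ℕ.≮⇒≥ ¬p) (ℕ.≮⇒≥ ¬q)))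

  product-zero : ∀ {x y} → (x ≈ 0#) ⊎ (y ≈ 0#) → x * y ≈ 0#
  product-zero (inj₁ x≈0) = ≈-trans (*-congʳ x≈0) (zeroˡ _)
  product-zero (inj₂ y≈0) = ≈-trans (*-congˡ y≈0) (zeroʳ _)

  record Series : Set (c ⊔ ℓ ⊔ a) where
    field
      at      : Word → K
      resp    : ∀ {u v} → u ~ v → at u ≈ at v
      bounded : ∃[ d ] ∀ u → d ℕ.< length u → at u ≈ 0#
  open Series

  seriesAlgebra : RawAlgebra K (c ⊔ ℓ ⊔ a) (ℓ ⊔ a)
  seriesAlgebra = record
    { Carrier = Series
    ; _≈_ = λ f g → ∀ u → at f u ≈ at g u
    ; _+_ = add
    ; _*_ = λ f g → record
      { at      = λ w → ∑ꟳ w (λ u v → at f u * at g v)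
      ; resp    = ∑ꟳ-resp-~ _ (λ p q → *-cong (resp f p) (resp g q))
      ; bounded = proj₁ (bounded f) ℕ.+ proj₁ (bounded g) , product-bounded f g
      }
    ; _·_ = λ k f → record
      { at      = λ u → k * at f u
      ; resp    = λ p → *-congˡ (resp f p)
      ; bounded = map₂ (λ z u lt → product-zero (inj₂ (z u lt))) (bounded f)
      }
    ; -_  = λ f → record
      { at      = λ u → - at f u
      ; resp    = λ p → -‿cong (resp f p)
      ; bounded = map₂ (λ z u lt → ≈-trans (-‿cong (z u lt)) -0#≈0#) (bounded f)
      }
    ; 0#  = record { at = λ _ → 0# ; resp = λ _ → ≈-refl ; bounded = 0 , λ _ _ → ≈-refl }
    ; 1#  = record
      { at      = λ u → ⟦ [] ~? u ⟧
      ; resp    = λ {u} {v} p → ≈-reflexive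
          (⟦⟧-cong (λ q → ~-trans q p) (λ q → ~-trans q (~-sym p)) ([] ~? u) ([] ~? v))
      ; bounded = 0 , λ u lt → ≈-reflexive
          (⟦⟧-no ([] ~? u) (λ q → ℕ.<⇒≢ lt (length-~ q)))
      }
    }
    where
    add : Series → Series → Series
    add f g = record
      { at      = λ u → at f u + at g u
      ; resp    = λ p → +-cong (resp f p) (resp g p)
      ; bounded = let d , f≈0 = bounded f ; e , g≈0 = bounded g in
          d ℕ.+ e , λ u lt → ≈-trans
            (+-cong (f≈0 u (ℕ.≤-<-trans (ℕ.m≤m+n d e) lt))
                    (g≈0 u (ℕ.≤-<-trans (ℕ.m≤n+m e d) lt)))
            (+-identityˡ 0#)
      }
    product-bounded : ∀ f g w → proj₁ (bounded f) ℕ.+ proj₁ (bounded g) ℕ.< length w →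
                      ∑ꟳ w (λ u v → at f u * at g v) ≈ 0#
    product-bounded f g w lt = ∑-zero (All.map vanish (factorisations-sound w))
      where
      vanish : ∀ {uv} → (proj₁ uv ++ proj₂ uv) ~ w → at f (proj₁ uv) * at g (proj₂ uv) ≈ 0#
      vanish {u , v} uv~w with exceeds _ _ (length u) (length v)
        (subst (_ ℕ.<_) (≡.trans (≡.sym (length-~ uv~w)) (List.length-++ u)) lt)
      ... | inj₁ p = product-zero (inj₁ (proj₂ (bounded f) u p))
      ... | inj₂ p = product-zero (inj₂ (proj₂ (bounded g) v p))

  module 𝕜[x] = RawAlgebra seriesAlgebra

  -- The coefficient of u in M_I counts the tuples j₁ < ⋯ < jₘ whose monomial
  -- is u; by monomial-bound all of them have entries below bound u.
  M : Sentence → Series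
  M I = record
    { at      = at-M
    ; resp    = λ {u} {v} u~v → ≈-trans
        (∑-cong (increasing (length I) (bound u)) (λ js → ≈-reflexive
          (⟦⟧-cong (λ q → ~-trans q u~v) (λ q → ~-trans q (~-sym u~v))
                   (monomial I js ~? u) (monomial I js ~? v))))
        (≈-reflexive (cong (λ N → ∑ (increasing (length I) N) (λ js → ⟦ monomial I js ~? v ⟧))
                           (bound-~ u~v)))
    ; bounded = ∣ I ∣ , λ u lt → ∑-zero (All.map
        (λ {js} eq → ≈-reflexive (⟦⟧-no (monomial I js ~? u)
          (λ q → ℕ.<⇒≢ lt (≡.trans (≡.sym (length-monomial I js eq)) (length-~ q)))))
        (All.filter⁺ (linked? ℕ._<?_) (tuples-length (length I) (upTo (bound u)))))
    }
    where
    at-M : Word → K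
    at-M u = ∑ (increasing (length I) (bound u)) (λ js → ⟦ monomial I js ~? u ⟧)

  QSym : Series → Set (c ⊔ ℓ ⊔ a)
  QSym = 𝕜[x].Span M

  M∈QSym : ∀ I → QSym (M I)
  M∈QSym I = [ (1# , I) ] , λ u → ≈-sym (≈-trans (+-identityʳ _) (*-identityˡ _))

  _≟ˢˢ_ : DecidableEquality (Sentence × Sentence)
  _≟ˢˢ_ = ≡-dec _≟ˢ_ _≟ˢ_

  module NSym = FreeModule R _≟ˢ_
  module NSym⊗NSym = FreeModule R _≟ˢˢ_

  NSym NSym⊗NSym : Set (c ⊔ a)
  NSym      = NSym.Free
  NSym⊗NSym = NSym⊗NSym.Free

  H : Sentence → NSym
  H = NSym.basis

  ΔH : Sentence → NSym⊗NSym
  ΔH I = map (1# ,_) (cutSentences I)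

  Δ : NSym → NSym⊗NSym
  Δ = concatMap (λ (k , I) → k NSym⊗NSym.·ᶠ ΔH I)

  Homogeneous : ℕ → NSym → Set (ℓ ⊔ a)
  Homogeneous d h = ∀ I → ∣ I ∣ ≢ d → NSym.coeff h I ≈ 0#

  -- ⨁_d (NSym_d)*, as the linear functionals on NSym = ⨁_d NSym_d which
  -- vanish on NSym_d for all large d.
  record GrDual : Set (c ⊔ ℓ ⊔ a) where
    field
      app      : NSym → K
      isLinear : NSym.IsLinear app
      bounded  : ∃[ d ] ∀ {e} → d ℕ.< e → ∀ h → Homogeneous e h → app h ≈ 0#

    open LeftModuleMorphisms.IsLeftModuleHomomorphism isLinear public
  open GrDual using (app)

  infixr 7 _⊗_
  _⊗_ : GrDual → GrDual → NSym⊗NSym → K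
  f ⊗ g = NSym⊗NSym.extend (λ (P , Q) → app f (H P) * app g (H Q))

  homogeneous-H : ∀ I → Homogeneous ∣ I ∣ (H I)
  homogeneous-H I J ne = ≈-trans (NSym.extend-basis (λ L → ⟦ L ≟ˢ J ⟧) I)
    (≈-reflexive (⟦⟧-no (I ≟ˢ J) (λ { refl → ne refl })))

  extend-Δ : ∀ ψ h → NSym⊗NSym.extend ψ (Δ h) ≈ NSym.extend (λ I → NSym⊗NSym.extend ψ (ΔH I)) h
  extend-Δ ψ []            = ≈-refl
  extend-Δ ψ ((k , I) ∷ h) = ≈-trans
    (NSym⊗NSym.extend-++ ψ (k NSym⊗NSym.·ᶠ ΔH I) (Δ h))
    (+-cong (NSym⊗NSym.extend-· ψ k (ΔH I)) (extend-Δ ψ h))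

  ⊗-ΔH-vanish : ∀ f g I → proj₁ (GrDual.bounded f) ℕ.+ proj₁ (GrDual.bounded g) ℕ.< ∣ I ∣ →
                (f ⊗ g) (ΔH I) ≈ 0#
  ⊗-ΔH-vanish f g I lt = ≈-trans (∑-map {Y = K × Sentence × Sentence} (1# ,_) (λ (k , P , Q) → k * (app f (H P) * app g (H Q))) (cutSentences I))
    (∑-zero (All.map (λ {PQ} → vanish {PQ}) (cutSentences-size I)))
    where
    vanish : ∀ {PQ} → ∣ proj₁ PQ ∣ ℕ.+ ∣ proj₂ PQ ∣ ≡ ∣ I ∣ →
             1# * (app f (H (proj₁ PQ)) * app g (H (proj₂ PQ))) ≈ 0#
    vanish {P , Q} eq = product-zero (inj₂ (product-zero (go
      (exceeds _ _ ∣ P ∣ ∣ Q ∣ (subst (_ ℕ.<_) (≡.sym eq) lt)))))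
      where
      go : (proj₁ (GrDual.bounded f) ℕ.< ∣ P ∣) ⊎ (proj₁ (GrDual.bounded g) ℕ.< ∣ Q ∣) →
           (app f (H P) ≈ 0#) ⊎ (app g (H Q) ≈ 0#)
      go (inj₁ p) = inj₁ (proj₂ (GrDual.bounded f) p (H P) (homogeneous-H P))
      go (inj₂ p) = inj₂ (proj₂ (GrDual.bounded g) p (H Q) (homogeneous-H Q))

  H* : Sentence → GrDual
  H* I = record
    { app      = λ h → NSym.coeff h I
    ; isLinear = NSym.extend-isLinear (λ J → ⟦ J ≟ˢ I ⟧)
    ; bounded  = ∣ I ∣ , λ lt h homog → homog I (ℕ.<⇒≢ lt)
    }

  grDualAlgebra : RawAlgebra K (c ⊔ ℓ ⊔ a) (c ⊔ ℓ ⊔ a)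
  grDualAlgebra = record
    { Carrier = GrDual
    ; _≈_ = λ f g → ∀ h → app f h ≈ app g h
    ; _+_ = λ f g → record
      { app      = λ h → app f h + app g h
      ; isLinear = NSym.isLinear _
          (λ eq → +-cong (GrDual.⟦⟧-cong f eq) (GrDual.⟦⟧-cong g eq))
          (λ h h′ → ≈-trans (+-cong (GrDual.+ᴹ-homo f h h′) (GrDual.+ᴹ-homo g h h′))
                            (+-interchange _ _ _ _))
          (λ k h → ≈-trans (+-cong (GrDual.*ₗ-homo f k h) (GrDual.*ₗ-homo g k h))
                           (≈-sym (distribˡ k _ _)))
      ; bounded  = let d , f≈0 = GrDual.bounded f ; e , g≈0 = GrDual.bounded g in
          d ℕ.+ e , λ lt h homog → ≈-trans
            (+-cong (f≈0 (ℕ.≤-<-trans (ℕ.m≤m+n d e) lt) h homog)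
                    (g≈0 (ℕ.≤-<-trans (ℕ.m≤n+m e d) lt) h homog))
            (+-identityˡ 0#)
      }
    ; _*_ = λ f g → record
      { app      = λ h → (f ⊗ g) (Δ h)
      ; isLinear = NSym.isLinear _
          (λ {h} {h′} eq → ≈-trans (extend-Δ _ h)
            (≈-trans (NSym.extend-cong _ {h} {h′} eq) (≈-sym (extend-Δ _ h′))))
          (λ h h′ → ≈-trans (extend-Δ _ (h ++ h′))
            (≈-trans (NSym.extend-++ _ h h′) (+-cong (≈-sym (extend-Δ _ h)) (≈-sym (extend-Δ _ h′)))))
          (λ k h → ≈-trans (extend-Δ _ (k NSym.·ᶠ h))
            (≈-trans (NSym.extend-· _ k h) (*-congˡ (≈-sym (extend-Δ _ h)))))
      ; bounded  = proj₁ (GrDual.bounded f) ℕ.+ proj₁ (GrDual.bounded g) ,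
          λ lt h homog → ≈-trans (extend-Δ _ h)
            (NSym.extend-vanish _ h (λ I → product-zero (vanish f g {h = h} lt homog I)))
      }
    ; _·_ = λ k f → record
      { app      = λ h → k * app f h
      ; isLinear = NSym.isLinear _
          (λ eq → *-congˡ (GrDual.⟦⟧-cong f eq))
          (λ h h′ → ≈-trans (*-congˡ (GrDual.+ᴹ-homo f h h′)) (distribˡ k _ _))
          (λ l h → ≈-trans (*-congˡ (GrDual.*ₗ-homo f l h)) (x∙yz≈y∙xz k l _))
      ; bounded  = map₂ (λ z lt h homog → product-zero (inj₂ (z lt h homog))) (GrDual.bounded f)
      }
    ; -_  = λ f → record
      { app      = λ h → - app f h
      ; isLinear = NSym.isLinear _
          (λ eq → -‿cong (GrDual.⟦⟧-cong f eq))
          (λ h h′ → ≈-trans (-‿cong (GrDual.+ᴹ-homo f h h′)) (≈-sym (-‿+-comm _ _)))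
          (λ k h → ≈-trans (-‿cong (GrDual.*ₗ-homo f k h)) (-‿distribʳ-* k _))
      ; bounded  = map₂ (λ z lt h homog → ≈-trans (-‿cong (z lt h homog)) -0#≈0#) (GrDual.bounded f)
      }
    ; 0#  = record
      { app      = λ _ → 0#
      ; isLinear = NSym.isLinear _ (λ _ → ≈-refl) (λ _ _ → ≈-sym (+-identityˡ 0#))
                                   (λ k _ → ≈-sym (zeroʳ k))
      ; bounded  = 0 , λ _ _ _ → ≈-refl
      }
    -- the counit of Δ
    ; 1#  = H* []
    }
    where
    vanish : ∀ f g {e h} → proj₁ (GrDual.bounded f) ℕ.+ proj₁ (GrDual.bounded g) ℕ.< e →
             Homogeneous e h → ∀ I → (NSym.coeff h I ≈ 0#) ⊎ ((f ⊗ g) (ΔH I) ≈ 0#)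
    vanish f g {e} lt homog I with ∣ I ∣ ℕ.≟ e
    ... | yes refl = inj₂ (⊗-ΔH-vanish f g I lt)
    ... | no  ne   = inj₁ (homog I ne)

{-# OPTIONS --safe #-}
-- Reading off the subwords π i u in order of increasing i and dropping the empty
-- ones gives each monomial u a sentence, its shape, and M_I is the sum of all
-- monomials of shape I.  Hence, A being finite, QSym consists of the series whose
-- coefficients depend only on the shape, and such a series is the same thing as a
-- functional on NSym of bounded degree.  A factorisation of u cuts every subword
-- π i u in two independently of the others, so the factorisations of u match the
-- cuts of its shape, and the product of series becomes the product dual to Δ.
module Submission where

open import Defs
open import Algebra.Apartness.Bundles using (HeytingField)
open import Data.Fin.Base using (Fin)
open import Data.Nat.Base using (ℕ)
open import Data.Product.Base using (Σ; _×_; _,_)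
open import Function.Bundles using (_↔_)
open import Algebra.Bundles using (CommutativeRing)
open import Algebra.Module.Bundles.Raw using (RawLeftModule)
open import Algebra.Morphism.Structures using (module MonoidMorphisms)
import Algebra.Properties.CommutativeSemigroup as CommutativeSemigroupProperties
import Algebra.Properties.Ring as RingProperties
open import Data.Empty using (⊥-elim)
open import Data.List.Base
  using (List; []; _∷_; [_]; _++_; map; concat; zipWith; length; upTo; allFin;
         cartesianProductWith; deduplicate)
import Data.List.Properties as List
open import Data.List.Membership.Propositional using (_∈_)
open import Data.List.Membership.Propositional.Properties
  using (∈-cartesianProductWith⁺; ∈-upTo⁺; ∈-filter⁺; ∈-filter⁻; ∈-map⁺; ∈-allFin;
         ∈-++⁺ˡ; ∈-++⁺ʳ; ∈-deduplicate⁺)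
open import Data.List.NonEmpty.Base using (List⁺; _∷_; toList; _∷⁺_)
open import Data.List.Relation.Unary.All as All using (All; []; _∷_)
import Data.List.Relation.Unary.All.Properties as All
open import Data.List.Relation.Unary.AllPairs using (AllPairs; []; _∷_)
import Data.List.Relation.Unary.AllPairs.Properties as AllPairs
open import Data.List.Relation.Unary.Any using (here; there)
open import Data.List.Relation.Unary.Linked using (linked?)
open import Data.List.Relation.Unary.Linked.Properties using (AllPairs⇒Linked; Linked⇒AllPairs)
open import Data.List.Relation.Unary.Unique.Propositional using (Unique)
import Data.List.Relation.Unary.Unique.Propositional.Properties as Unique
open import Data.List.Relation.Unary.Unique.DecPropositional.Properties using (deduplicate-!)
open import Data.Nat.Base as ℕ using (zero; suc)
import Data.Nat.Properties as ℕ
open import Data.Product.Base using (proj₁; proj₂; map₁)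
open import Data.Sum.Base using (_⊎_; inj₁; inj₂)
open import Function.Base using (_∘_)
open import Function.Bundles using (Inverse)
open import Relation.Binary.Definitions using (DecidableEquality; tri<; tri≈; tri>)
open import Relation.Binary.PropositionalEquality as ≡
  using (_≡_; _≢_; refl; cong; cong₂; subst)
open import Relation.Nullary using (¬_; yes; no)

-- Monomials and their shapes

module Shapes {a} {A : Set a} (_≟_ : DecidableEquality A) where

  open Words _≟_
  open Sentences _≟_

  Increasing : List ℕ → Set
  Increasing = AllPairs ℕ._<_

  row : ℕ → List A → Word
  row j = map (_, j)

  π-row : ∀ j w → π j (row j w) ≡ w
  π-row j []      = refl
  π-row j (a ∷ w) = ≡.trans (π-hit a j (row j w)) (cong (a ∷_) (π-row j w))

  row-⊥ : ∀ {i j} → i ≢ j → ∀ w → i ⊥ row j w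
  row-⊥ i≢j w = All.map⁺ (All.universal (λ _ → i≢j) w)

  monomial-⊥ : ∀ {i} I {js} → All (i ℕ.<_) js → i ⊥ monomial I js
  monomial-⊥ []      _          = []
  monomial-⊥ (w ∷ I) []         = []
  monomial-⊥ (w ∷ I) (i<j ∷ lt) = All.++⁺ (row-⊥ (ℕ.<⇒≢ i<j) (toList w)) (monomial-⊥ I lt)

  π-row-++ : ∀ {j} w u → j ⊥ u → π j (row j w ++ u) ≡ w
  π-row-++ {j} w u j⊥u = begin
    π j (row j w ++ u)      ≡⟨ π-++ j (row j w) u ⟩
    π j (row j w) ++ π j u  ≡⟨ cong₂ _++_ (π-row j w) (⊥⇒π u j⊥u) ⟩
    w ++ []                 ≡⟨ List.++-identityʳ w ⟩
    w                       ∎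
    where open ≡.≡-Reasoning

  ++-cancelˡ-~ : ∀ p {u v} → (p ++ u) ~ (p ++ v) → u ~ v
  ++-cancelˡ-~ []      eq = eq
  ++-cancelˡ-~ (x ∷ p) eq = ++-cancelˡ-~ p (∷-cancel-~ x eq)

  ∷-absent : ∀ {a i u v} → i ⊥ v → ¬ (((a , i) ∷ u) ~ v)
  ∷-absent {a} {i} {u} {v} i⊥v eq
    with ≡.trans (≡.sym (π-hit a i u)) (≡.trans (π-resp-~ i eq) (⊥⇒π v i⊥v))
  ... | ()

  toList-injective : ∀ {v w : List⁺ A} → toList v ≡ toList w → v ≡ w
  toList-injective refl = refl

  -- The head position is the smallest one, so if the two heads differ, the smaller one has no
  -- letter in the other monomial; words being non-empty, this is a contradiction. If they agree,
  -- `π` at that position reads off the first word of each side, and cancelling the common row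
  -- leaves the tails.
  monomial-injective : ∀ I J {is js} → length is ≡ length I → length js ≡ length J →
                       Increasing is → Increasing js →
                       monomial I is ~ monomial J js → I ≡ J × is ≡ js
  monomial-injective []      []      {[]}     {[]}     _ _ _ _ _ = refl , refl
  monomial-injective []      (v ∷ J) {[]}     {j ∷ js} _ _ _ _ eq with length-~ eq
  ... | ()
  monomial-injective (w ∷ I) []      {i ∷ is} {[]}     _ _ _ _ eq with length-~ eq
  ... | ()
  monomial-injective (w ∷ I) (v ∷ J) {i ∷ is} {j ∷ js} p q (i< ∷ inc) (j< ∷ inc′) eq
    with ℕ.<-cmp i j
  ... | tri< i<j _ _ = ⊥-elim (∷-absent
          (monomial-⊥ (v ∷ J) (i<j ∷ All.map (ℕ.<-trans i<j) j<)) eq)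
  ... | tri> _ _ j<i = ⊥-elim (∷-absent
          (monomial-⊥ (w ∷ I) (j<i ∷ All.map (ℕ.<-trans j<i) i<)) (~-sym eq))
  ... | tri≈ _ refl _ with toList-injective (begin
            toList w                                ≡⟨ π-row-++ (toList w) _ (monomial-⊥ I i<) ⟨
            π i (row i (toList w) ++ monomial I is) ≡⟨ π-resp-~ i eq ⟩
            π i (row i (toList v) ++ monomial J js) ≡⟨ π-row-++ (toList v) _ (monomial-⊥ J j<) ⟩
            toList v                                ∎)
    where open ≡.≡-Reasoning
  ... | refl with monomial-injective I J (ℕ.suc-injective p) (ℕ.suc-injective q) inc inc′
                    (++-cancelˡ-~ (row i (toList w)) eq)
  ... | refl , refl = refl , refl

  -- A layout exhibits `u` as one of the summands of `M sentence`.
  record Layout (u : Word) : Set a where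
    constructor layout
    field
      sentence   : Sentence
      positions  : List ℕ
      aligned    : length positions ≡ length sentence
      ascending  : Increasing positions
      spells     : monomial sentence positions ~ u

  -- One step of an insertion sort: the letter moves right past the rows at smaller positions, then
  -- opens a new word or joins the word already at its position. The second component carries strict
  -- lower bounds over to the new positions, which keeps them increasing in the recursive case.
  insert : ∀ x I js → length js ≡ length I → Increasing js →
           Σ (Layout (x ∷ monomial I js)) λ L →
             ∀ {k} → k ℕ.< proj₂ x → All (k ℕ.<_) js → All (k ℕ.<_) (Layout.positions L)
  insert (a , i) [] [] _ _ =
    layout [ a ∷ [] ] [ i ] refl ([] ∷ []) ~-refl , λ k<i _ → k<i ∷ []
  insert x@(a , i) (w ∷ I) (j ∷ js) eq (j< ∷ inc) with ℕ.<-cmp i j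
  ... | tri< i<j _ _ =
    layout ((a ∷ []) ∷ w ∷ I) (i ∷ j ∷ js) (cong suc eq)
           ((i<j ∷ All.map (ℕ.<-trans i<j) j<) ∷ j< ∷ inc) ~-refl
    , _∷_
  ... | tri≈ _ refl _ =
    layout ((a ∷⁺ w) ∷ I) (j ∷ js) eq (j< ∷ inc) ~-refl , λ _ lt → lt
  ... | tri> _ i≢j j<i with insert x I js (ℕ.suc-injective eq) inc
  ... | layout I′ js′ eq′ inc′ sp , above =
    layout (w ∷ I′) (j ∷ js′) (cong suc eq′) (above j<i j< ∷ inc′)
      (~-trans (++-respʳ-~ (row j (toList w)) sp)
               (shift (row j (toList w)) (row-⊥ i≢j (toList w))))
    , λ { k<i (k<j ∷ lt) → k<j ∷ above k<i lt }

  layoutOf : ∀ u → Layout u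
  layoutOf []      = layout [] [] refl [] ~-refl
  layoutOf (x ∷ u) with layoutOf u
  ... | layout I js eq inc sp with insert x I js eq inc
  ... | layout I′ js′ eq′ inc′ sp′ , _ =
    layout I′ js′ eq′ inc′ (~-trans sp′ (∷-resp-~ x sp))

  shape : Word → Sentence
  shape u = Layout.sentence (layoutOf u)

  -- This makes `shape` invariant under `_~_` and pins down the only tuple that `at-M` can count.
  layout-unique : ∀ {u} I {js} → length js ≡ length I → Increasing js → monomial I js ~ u →
                  I ≡ shape u × js ≡ Layout.positions (layoutOf u)
  layout-unique {u} I eq inc sp = monomial-injective I sentence eq aligned inc ascending
    (~-trans sp (~-sym spells))
    where open Layout (layoutOf u)

  shape-monomial : ∀ I {js} → length js ≡ length I → Increasing js → shape (monomial I js) ≡ I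
  shape-monomial I eq inc = ≡.sym (proj₁ (layout-unique I eq inc ~-refl))

  shape-resp-~ : ∀ {u v} → u ~ v → shape u ≡ shape v
  shape-resp-~ {u} u~v = proj₁ (layout-unique sentence aligned ascending (~-trans spells u~v))
    where open Layout (layoutOf u)

  ∣shape∣ : ∀ u → ∣ shape u ∣ ≡ length u
  ∣shape∣ u = ≡.trans (≡.sym (length-monomial sentence positions aligned)) (length-~ spells)
    where open Layout (layoutOf u)

  -- Monomials of the halves of a cut

  blocks : List (List A) → List ℕ → Word
  blocks ws js = concat (zipWith (λ w j → row j w) ws js)

  occupied : List (List A) → List ℕ → List ℕ
  occupied []             _        = []
  occupied (w ∷ ws)       []       = []
  occupied ([] ∷ ws)      (j ∷ js) = occupied ws js
  occupied ((a ∷ w) ∷ ws) (j ∷ js) = j ∷ occupied ws js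

  occupied-All : ∀ {p} {P : ℕ → Set p} ws {js} → All P js → All P (occupied ws js)
  occupied-All []             _        = []
  occupied-All (w ∷ ws)       []       = []
  occupied-All ([] ∷ ws)      (_ ∷ ps) = occupied-All ws ps
  occupied-All ((a ∷ w) ∷ ws) (p ∷ ps) = p ∷ occupied-All ws ps

  occupied-increasing : ∀ ws {js} → Increasing js → Increasing (occupied ws js)
  occupied-increasing []             _          = []
  occupied-increasing (w ∷ ws)       []         = []
  occupied-increasing ([] ∷ ws)      (_ ∷ inc)  = occupied-increasing ws inc
  occupied-increasing ((a ∷ w) ∷ ws) (lt ∷ inc) = occupied-All ws lt ∷ occupied-increasing ws inc

  length-occupied : ∀ ws js → length js ≡ length ws → length (occupied ws js) ≡ length (tilde ws)
  length-occupied []             _        _  = refl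
  length-occupied ([] ∷ ws)      (j ∷ js) eq = length-occupied ws js (ℕ.suc-injective eq)
  length-occupied ((a ∷ w) ∷ ws) (j ∷ js) eq = cong suc (length-occupied ws js (ℕ.suc-injective eq))

  monomial-tilde : ∀ ws js → length js ≡ length ws → monomial (tilde ws) (occupied ws js) ≡ blocks ws js
  monomial-tilde []             _        _  = refl
  monomial-tilde ([] ∷ ws)      (j ∷ js) eq = monomial-tilde ws js (ℕ.suc-injective eq)
  monomial-tilde ((a ∷ w) ∷ ws) (j ∷ js) eq =
    cong (row j (a ∷ w) ++_) (monomial-tilde ws js (ℕ.suc-injective eq))

  -- Both halves of a cut use the positions of the whole sentence, so `blocks` has to admit empty
  -- words. Deleting these together with their positions leaves the word unchanged and turns it into
  -- a `monomial` at positions that still increase.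
  shape-blocks : ∀ ws js → length js ≡ length ws → Increasing js → shape (blocks ws js) ≡ tilde ws
  shape-blocks ws js eq inc = begin
    shape (blocks ws js)                         ≡⟨ cong shape (monomial-tilde ws js eq) ⟨
    shape (monomial (tilde ws) (occupied ws js)) ≡⟨ shape-monomial (tilde ws)
      (length-occupied ws js eq) (occupied-increasing ws inc) ⟩
    tilde ws                                     ∎
    where open ≡.≡-Reasoning

  HaveLength : ℕ → List (List A) × List (List A) → Set
  HaveLength m (us , vs) = length us ≡ m × length vs ≡ m

  cuts-length : ∀ I → All (HaveLength (length I)) (cuts I)
  cuts-length []      = (refl , refl) ∷ []
  cuts-length (w ∷ I) = go (splittings (toList w))
    where
    go : ∀ xs → All (HaveLength (suc (length I)))
                    (cartesianProductWith (λ (u , v) (us , vs) → u ∷ us , v ∷ vs) xs (cuts I))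
    go []       = []
    go (_ ∷ xs) = All.++⁺
      (All.map⁺ (All.map (λ (p , q) → cong suc p , cong suc q) (cuts-length I))) (go xs)

  -- A monomial of each shape

  representative : Sentence → Word
  representative I = monomial I (upTo (length I))

  shape-representative : ∀ I → shape (representative I) ≡ I
  shape-representative I = shape-monomial I (List.length-upTo (length I)) (upTo-increasing (length I))
    where
    upTo-increasing : ∀ n → Increasing (upTo n)
    upTo-increasing n = AllPairs.applyUpTo⁺₁ (λ i → i) n (λ i<j _ → i<j)

  length-representative : ∀ I → length (representative I) ≡ ∣ I ∣
  length-representative I = length-monomial I _ (List.length-upTo (length I))

  -- Enumeration of increasing tuples

  tuples-unique : ∀ {x} {X : Set x} m {xs : List X} → Unique xs → Unique (tuples m xs)
  tuples-unique zero    u = [] ∷ []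
  tuples-unique (suc m) u = Unique.cartesianProductWith⁺ _∷_ List.∷-injective u (tuples-unique m u)

  tuples-complete : ∀ {x} {X : Set x} {xs js : List X} → All (_∈ xs) js → js ∈ tuples (length js) xs
  tuples-complete []       = here refl
  tuples-complete (p ∷ ps) = ∈-cartesianProductWith⁺ _∷_ p (tuples-complete ps)

  increasing-unique : ∀ m N → Unique (increasing m N)
  increasing-unique m N = Unique.filter⁺ (linked? ℕ._<?_) (tuples-unique m (Unique.upTo⁺ N))

  increasing-sound : ∀ m N {js} → js ∈ increasing m N → length js ≡ m × Increasing js
  increasing-sound m N js∈ with ∈-filter⁻ (linked? ℕ._<?_) {xs = tuples m (upTo N)} js∈
  ... | js∈′ , l = All.lookup (tuples-length m (upTo N)) js∈′ , Linked⇒AllPairs ℕ.<-trans l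

  increasing-complete : ∀ {m N js} → length js ≡ m → Increasing js → All (ℕ._< N) js →
                        js ∈ increasing m N
  increasing-complete refl inc lt = ∈-filter⁺ (linked? ℕ._<?_)
    (tuples-complete (All.map ∈-upTo⁺ lt)) (AllPairs⇒Linked inc)

  -- Enumeration of the sentences of bounded size

  module _ (alphabet : List A) (covers : ∀ a → a ∈ alphabet) where

    startWord : A → Sentence → Sentence
    startWord a I = (a ∷ []) ∷ I

    growWord : A → Sentence → Sentence
    -- A default value: it only repeats the empty sentence, which `sentences (suc d)` lists anyway.
    growWord a []      = []
    growWord a (w ∷ I) = (a ∷⁺ w) ∷ I

    -- A non-empty sentence arises from one with a letter less by starting a new first word or by
    -- lengthening the first word on the left. Listing `[]` at every stage covers all sizes up to
    -- `d` instead of `d` alone.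
    sentences : ℕ → List Sentence
    sentences zero    = [ [] ]
    sentences (suc d) = [] ∷
      cartesianProductWith startWord alphabet (sentences d) ++
      cartesianProductWith growWord alphabet (sentences d)

    sentences-complete : ∀ d I → ∣ I ∣ ℕ.≤ d → I ∈ sentences d
    sentences-complete zero    []                  _ = here refl
    sentences-complete (suc d) []                  _ = here refl
    sentences-complete (suc d) ((a ∷ []) ∷ I)      (ℕ.s≤s le) = there (∈-++⁺ˡ
      (∈-cartesianProductWith⁺ startWord (covers a) (sentences-complete d I le)))
    sentences-complete (suc d) ((a ∷ (b ∷ w)) ∷ I) (ℕ.s≤s le) = there
      (∈-++⁺ʳ (cartesianProductWith startWord alphabet (sentences d))
        (∈-cartesianProductWith⁺ growWord (covers a) (sentences-complete d ((b ∷ w) ∷ I) le)))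


-- Sums and the coefficients of `M I`

module Coefficients {c ℓ a} (R : CommutativeRing c ℓ) {A : Set a} {n : ℕ} (finite : A ↔ Fin n) where

  open CommutativeRing R hiding (_-_) renaming
    (Carrier to K; refl to ≈-refl; sym to ≈-sym; trans to ≈-trans; reflexive to ≈-reflexive)
  open import Relation.Binary.Reasoning.Setoid setoid
  open RingProperties (CommutativeRing.ring R) using (-0#≈0#; -‿+-comm; -‿distribʳ-*)
  open CommutativeSemigroupProperties (CommutativeRing.*-commutativeSemigroup R) using (x∙yz≈y∙xz)
  open Setup R finite
  open Shapes _≟ᴬ_
  open Series
  open GrDual using (app)

  ∑-cartesianProductWith :
    ∀ {x y z} {X : Set x} {Y : Set y} {Z : Set z} (f : X → Y → Z) (g : Z → K) xs ys →
    ∑ (cartesianProductWith f xs ys) g ≈ ∑ xs (λ x → ∑ ys (λ y → g (f x y)))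
  ∑-cartesianProductWith f g []       ys = ≈-refl
  ∑-cartesianProductWith f g (x ∷ xs) ys = ≈-trans (∑-++ g (map (f x) ys) _)
    (+-cong (∑-map (f x) g ys) (∑-cartesianProductWith f g xs ys))

  ∑-neg : ∀ {x} {X : Set x} (f : X → K) xs → ∑ xs (λ x → - f x) ≈ - ∑ xs f
  ∑-neg f []       = ≈-sym -0#≈0#
  ∑-neg f (x ∷ xs) = ≈-trans (+-congˡ (∑-neg f xs)) (-‿+-comm _ _)

  extend-congˡ : ∀ {φ ψ} → (∀ I → φ I ≈ ψ I) → ∀ h → NSym.extend φ h ≈ NSym.extend ψ h
  extend-congˡ eq h = ∑-cong h (λ (_ , I) → *-congˡ (eq I))

  -- By `layout-unique` at most one tuple spells `u`, and only if `I` is the shape of `u`. In that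
  -- case `monomial-bound` puts this tuple among those summed over, so that it contributes exactly
  -- once.
  at-M : ∀ I u → at (M I) u ≈ ⟦ I ≟ˢ shape u ⟧
  at-M I u with I ≟ˢ shape u
  ... | no I≢ = ∑-zero (All.tabulate λ {js} js∈ →
    let eq , inc = increasing-sound (length I) (bound u) js∈ in
    ≈-reflexive (⟦⟧-no (monomial I js ~? u) (λ sp → I≢ (proj₁ (layout-unique I eq inc sp)))))
  ... | yes refl = begin
    ∑ L (λ js → ⟦ monomial sentence js ~? u ⟧)
      ≈⟨ ∑-cong-All (All.tabulate λ {js} js∈ →
           ≈-trans (≈-reflexive (indicator js js∈)) (≈-sym (*-identityʳ _))) ⟩
    ∑ L (λ js → ⟦ positions ≟ᴸ js ⟧ * 1#)
      ≈⟨ ∑-δ _≟ᴸ_ (λ _ → 1#) (increasing-unique (length sentence) (bound u))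
           (increasing-complete aligned ascending (monomial-bound sentence positions aligned spells)) ⟩
    1# ∎
    where
    open Layout (layoutOf u)
    L = increasing (length sentence) (bound u)
    _≟ᴸ_ = List.≡-dec ℕ._≟_
    indicator : ∀ js → js ∈ L → ⟦ monomial sentence js ~? u ⟧ ≡ ⟦ positions ≟ᴸ js ⟧
    indicator js js∈ = ⟦⟧-cong
      (λ sp → let eq , inc = increasing-sound (length sentence) (bound u) js∈ in
              ≡.sym (proj₂ (layout-unique sentence eq inc sp)))
      (λ { refl → spells }) (monomial sentence js ~? u) (positions ≟ᴸ js)

  -- Factorisations of a monomial and cuts of its sentence

  ∑-splittings-[] : ∀ w (G : List A → List A → K) → (∀ b p q → G (b ∷ p) q ≈ 0#) →
                    ∑ (splittings w) (λ (p , q) → G p q) ≈ G [] w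
  ∑-splittings-[] []      G _    = +-identityʳ _
  ∑-splittings-[] (b ∷ w) G vanish = ≈-trans
    (+-congˡ (≈-trans (∑-map _ _ (splittings w))
                      (∑-zero (All.universal (λ _ → vanish b _ _) (splittings w)))))
    (+-identityʳ _)

  -- The first letter (a , j) can head the right factor only if the left one has no
  -- letter in position j, that is, only if row j w goes to the right as a whole.
  ∑ꟳ-row : ∀ j w {s} → j ⊥ s → ∀ F →
    ∑ꟳ (row j w ++ s) F ≈
    ∑ (splittings w) (λ (p , q) → ∑ꟳ s (λ u v → F (row j p ++ u) (row j q ++ v)))
  ∑ꟳ-row j []      {s} j⊥s F = ≈-sym (+-identityʳ _)
  ∑ꟳ-row j (a ∷ w) {s} j⊥s F = begin
    ∑ꟳ (x ∷ row j w ++ s) F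
      ≈⟨ ∑ꟳ-∷ x (row j w ++ s) F ⟩
    ∑ꟳ (row j w ++ s) (step x F)
      ≈⟨ ∑ꟳ-row j w j⊥s (step x F) ⟩
    ∑ (splittings w) (λ (p , q) → ∑ꟳ s (λ u v → step x F (row j p ++ u) (row j q ++ v)))
      ≈⟨ ∑-cong (splittings w) (λ _ → ∑-+ _ _ (factorisations s)) ⟩
    ∑ (splittings w) (λ (p , q) → left (a ∷ p) q + right p q)
      ≈⟨ ∑-+ _ _ (splittings w) ⟩
    ∑ (splittings w) (λ (p , q) → left (a ∷ p) q) + ∑ (splittings w) (λ (p , q) → right p q)
      ≈⟨ +-cong (≈-sym (∑-map _ _ (splittings w))) (∑-splittings-[] w right right-∷) ⟩
    ∑ (map (map₁ (a ∷_)) (splittings w)) (λ (p , q) → left p q) + right [] w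
      -- `splittings (a ∷ w)` lists the splitting with empty left half first.
      ≈⟨ +-comm _ _ ⟩
    right [] w + ∑ (map (map₁ (a ∷_)) (splittings w)) (λ (p , q) → left p q)
      ≈⟨ +-congʳ right-[] ⟩
    left [] (a ∷ w) + ∑ (map (map₁ (a ∷_)) (splittings w)) (λ (p , q) → left p q) ∎
    where
    x = (a , j)
    left right : List A → List A → K
    left p q  = ∑ꟳ s (λ u v → F (row j p ++ u) (row j q ++ v))
    right p q = ∑ꟳ s (λ u v → ⟦ j ⊥? (row j p ++ u) ⟧ * F (row j p ++ u) (x ∷ row j q ++ v))
    right-∷ : ∀ b p q → right (b ∷ p) q ≈ 0#
    right-∷ b p q = ∑-zero (All.universal
      (λ (u , v) → ≈-trans
        (*-congʳ (≈-reflexive (⟦⟧-no (j ⊥? (row j (b ∷ p) ++ u)) (λ { (ne ∷ _) → ne refl }))))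
        (zeroˡ _))
      (factorisations s))
    right-[] : right [] w ≈ left [] (a ∷ w)
    -- Here `u` is a left factor of `s`, so it has no letter in position `j` either and the
    -- indicator is `1#`.
    right-[] = ∑-cong-All (All.map
      (λ {(u , v)} uv~s → ≈-trans
        (*-congʳ (≈-reflexive (⟦⟧-yes (j ⊥? u) (All.++⁻ˡ u (⊥-resp-~ (~-sym uv~s) j⊥s)))))
        (*-identityˡ _))
      (factorisations-sound s))

  -- The positions increase strictly, so the first row shares no position with the others and
  -- `∑ꟳ-row` splits it off. The statement is for all `F` because the induction hypothesis is
  -- applied to `F` with the two halves of the first row put in front of its arguments.
  ∑ꟳ-monomial : ∀ I {js} → length js ≡ length I → Increasing js → ∀ F →
    ∑ꟳ (monomial I js) F ≈ ∑ (cuts I) (λ (us , vs) → F (blocks us js) (blocks vs js))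
  ∑ꟳ-monomial []      {[]}     _  _            F = ≈-refl
  ∑ꟳ-monomial (w ∷ I) {j ∷ js} eq (lt ∷ inc) F = begin
    ∑ꟳ (row j (toList w) ++ monomial I js) F
      ≈⟨ ∑ꟳ-row j (toList w) (monomial-⊥ I lt) F ⟩
    ∑ (splittings (toList w)) (λ (p , q) → ∑ꟳ (monomial I js) (λ u v → F (row j p ++ u) (row j q ++ v)))
      ≈⟨ ∑-cong (splittings (toList w)) (λ (p , q) →
           ∑ꟳ-monomial I (ℕ.suc-injective eq) inc (λ u v → F (row j p ++ u) (row j q ++ v))) ⟩
    ∑ (splittings (toList w)) (λ (p , q) → ∑ (cuts I) (λ (us , vs) →
      F (row j p ++ blocks us js) (row j q ++ blocks vs js)))
      ≈⟨ ∑-cartesianProductWith _ _ (splittings (toList w)) (cuts I) ⟨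
    ∑ (cuts (w ∷ I)) (λ (us , vs) → F (blocks us (j ∷ js)) (blocks vs (j ∷ js))) ∎

  -- Series whose coefficients depend only on the shape

  ShapeInvariant : Series → Set _
  ShapeInvariant f = ∀ u v → shape u ≡ shape v → at f u ≈ at f v

  at-representative : ∀ f → ShapeInvariant f → ∀ u → at f u ≈ at f (representative (shape u))
  at-representative f inv u = inv _ _ (≡.sym (shape-representative (shape u)))

  -- Once `u` is replaced by the monomial of its layout, its factorisations are the pairs of
  -- `blocks` of the cuts. By `shape-blocks` their shapes are the two entries of `cutSentences`, so
  -- invariance allows the passage to representatives. The result is the sum that `ΔH (shape u)`
  -- prescribes for the dual product.
  at-product : ∀ f g → ShapeInvariant f → ShapeInvariant g → ∀ u →
    at (f 𝕜[x].* g) u ≈ ∑ (cutSentences (shape u))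
      (λ (P , Q) → at f (representative P) * at g (representative Q))
  at-product f g f-inv g-inv u = begin
    ∑ꟳ u (λ p q → at f p * at g q)
      ≈⟨ resp (f 𝕜[x].* g) spells ⟨
    ∑ꟳ (monomial sentence positions) (λ p q → at f p * at g q)
      ≈⟨ ∑ꟳ-monomial sentence aligned ascending _ ⟩
    ∑ (cuts sentence) (λ (us , vs) → at f (blocks us positions) * at g (blocks vs positions))
      ≈⟨ ∑-cong-All (All.map (λ {(us , vs)} (p , q) →
           *-cong (reduce f f-inv us p) (reduce g g-inv vs q)) (cuts-length sentence)) ⟩
    ∑ (cuts sentence) (λ (us , vs) → at f (representative (tilde us)) * at g (representative (tilde vs)))
      ≈⟨ ∑-map _ _ (cuts sentence) ⟨
    ∑ (cutSentences sentence) (λ (P , Q) → at f (representative P) * at g (representative Q)) ∎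
    where
    open Layout (layoutOf u)
    reduce : ∀ f → ShapeInvariant f → ∀ us → length us ≡ length sentence →
             at f (blocks us positions) ≈ at f (representative (tilde us))
    reduce f inv us eq = inv _ _ (≡.trans
      (shape-blocks us positions (≡.trans aligned (≡.sym eq)) ascending)
      (≡.sym (shape-representative (tilde us))))

  *-invariant : ∀ f g → ShapeInvariant f → ShapeInvariant g → ShapeInvariant (f 𝕜[x].* g)
  *-invariant f g f-inv g-inv u v eq = ≈-trans (at-product f g f-inv g-inv u)
    (≈-trans (≈-reflexive (cong (λ I → ∑ (cutSentences I) _) eq)) (≈-sym (at-product f g f-inv g-inv v)))

  M-invariant : ∀ I → ShapeInvariant (M I)
  M-invariant I u v eq = ≈-trans (at-M I u)
    (≈-trans (≈-reflexive (cong (λ J → ⟦ I ≟ˢ J ⟧) eq)) (≈-sym (at-M I v)))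

  QSym⇒invariant : ∀ f → QSym f → ShapeInvariant f
  QSym⇒invariant f (cs , f≈) u v eq = ≈-trans (f≈ u) (≈-trans (go cs) (≈-sym (f≈ v)))
    where
    go : ∀ cs → at (𝕜[x].linearCombination M cs) u ≈ at (𝕜[x].linearCombination M cs) v
    go []             = ≈-refl
    go ((k , I) ∷ cs) = +-cong (*-congˡ (M-invariant I u v eq)) (go cs)

  alphabet : List A
  alphabet = map (Inverse.from finite) (allFin n)

  alphabet-complete : ∀ a → a ∈ alphabet
  alphabet-complete a = subst (_∈ alphabet) (Inverse.strictlyInverseʳ finite a)
    (∈-map⁺ (Inverse.from finite) (∈-allFin (Inverse.to finite a)))

  at-linearCombination : ∀ (φ : Sentence → K) Is u →
    at (𝕜[x].linearCombination M (map (λ I → φ I , I) Is)) u ≈ ∑ Is (λ I → ⟦ shape u ≟ˢ I ⟧ * φ I)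
  at-linearCombination φ []       u = ≈-refl
  at-linearCombination φ (I ∷ Is) u = +-cong
    (≈-trans (*-comm _ _) (*-congʳ (≈-trans (at-M I u)
      (≈-reflexive (⟦⟧-cong ≡.sym ≡.sym (I ≟ˢ shape u) (shape u ≟ˢ I))))))
    (at-linearCombination φ Is u)

  -- The coefficient of `M I` has to be the value of `f` at monomials of shape `I`. Since `A` is
  -- finite, a finite list contains all sentences up to the degree bound of `f`.
  invariant⇒QSym : ∀ f → ShapeInvariant f → QSym f
  invariant⇒QSym f inv = map (λ I → φ I , I) Is , λ u →
    ≈-sym (≈-trans (at-linearCombination φ Is u) (expand u))
    where
    φ = λ I → at f (representative I)
    d = proj₁ (bounded f)
    -- `∑-δ` asks for a list without repetitions.
    Is = deduplicate _≟ˢ_ (sentences alphabet alphabet-complete d)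
    expand : ∀ u → ∑ Is (λ I → ⟦ shape u ≟ˢ I ⟧ * φ I) ≈ at f u
    expand u with length u ℕ.≤? d
    ... | yes le = ≈-trans
      (∑-δ _≟ˢ_ φ (deduplicate-! _≟ˢ_ _) (∈-deduplicate⁺ _≟ˢ_
        (sentences-complete alphabet alphabet-complete d (shape u)
          (subst (ℕ._≤ d) (≡.sym (∣shape∣ u)) le))))
      (≈-sym (at-representative f inv u))
    -- Should `shape u` occur in `Is` although `u` is longer than `d`, its coefficient is the value
    -- of `f` at `u`, which is zero beyond the degree bound.
    ... | no nle = ≈-trans (∑-zero (All.universal vanish Is)) (≈-sym (proj₂ (bounded f) u (ℕ.≰⇒> nle)))
      where
      vanish : ∀ I → ⟦ shape u ≟ˢ I ⟧ * φ I ≈ 0#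
      vanish I with shape u ≟ˢ I
      ... | no  _    = zeroˡ _
      ... | yes refl = product-zero (inj₂ (≈-trans (≈-sym (at-representative f inv u))
                                                   (proj₂ (bounded f) u (ℕ.≰⇒> nle))))

  -- For sums, multiples, negatives and products, closure is checked on shape invariance instead of
  -- on explicit combinations of the `M I`.
  QSym-isSubalgebra : 𝕜[x].IsSubalgebra QSym
  QSym-isSubalgebra = record
    { resp       = λ {f} {g} → resp-QSym {f} {g}
    ; +-closed   = λ {f} {g} p q → invariant⇒QSym (f 𝕜[x].+ g)
                     (λ u v eq → +-cong (QSym⇒invariant f p u v eq) (QSym⇒invariant g q u v eq))
    ; ·-closed   = λ k {f} p → invariant⇒QSym (k 𝕜[x].· f)
                     (λ u v eq → *-congˡ (QSym⇒invariant f p u v eq))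
    ; neg-closed = λ {f} p → invariant⇒QSym (𝕜[x].- f)
                     (λ u v eq → -‿cong (QSym⇒invariant f p u v eq))
    ; 0-closed   = [] , λ _ → ≈-refl
    ; *-closed   = λ {f} {g} p q → invariant⇒QSym (f 𝕜[x].* g)
                     (*-invariant f g (QSym⇒invariant f p) (QSym⇒invariant g q))
    -- The empty sentence admits only the empty tuple, so a coefficient of `M []` is that of the
    -- unit series plus `0#`.
    ; 1-closed   = resp-QSym {M []} {𝕜[x].1#} (λ _ → +-identityʳ _) (M∈QSym [])
    }
    where
    resp-QSym : ∀ {f g} → f 𝕜[x].≈ g → QSym f → QSym g
    resp-QSym f≈g (cs , f≈) = cs , λ u → ≈-trans (≈-sym (f≈g u)) (f≈ u)

  -- Shape-invariant series as functionals on `NSym`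

  dual : Series → GrDual
  dual f = record
    { app      = NSym.extend φ
    ; isLinear = NSym.extend-isLinear φ
    ; bounded  = proj₁ (bounded f) , λ lt h homog →
        NSym.extend-vanish φ h (λ I → product-zero (vanish {h = h} lt homog I))
    }
    where
    φ = λ I → at f (representative I)
    vanish : ∀ {e h} → proj₁ (bounded f) ℕ.< e → Homogeneous e h →
             ∀ I → (NSym.coeff h I ≈ 0#) ⊎ (φ I ≈ 0#)
    -- Either `I` has a size other than `e`, and `H I` has coefficient zero in `h`, or
    -- `representative I` has length `e`, beyond the degree bound of `f`.
    vanish {e} lt homog I with ∣ I ∣ ℕ.≟ e
    ... | no  ne   = inj₁ (homog I ne)
    ... | yes refl = inj₂ (proj₂ (bounded f) (representative I)
                       (subst (_ ℕ.<_) (≡.sym (length-representative I)) lt))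

  dual-H : ∀ f I → app (dual f) (H I) ≈ at f (representative I)
  dual-H f = NSym.extend-basis (at f ∘ representative)

  ⊗-ΔH : ∀ f g I → (f ⊗ g) (ΔH I) ≈ ∑ (cutSentences I) (λ (P , Q) → app f (H P) * app g (H Q))
  ⊗-ΔH f g I = ≈-trans (∑-map {Y = K × Sentence × Sentence} (1# ,_) _ (cutSentences I))
    (∑-cong (cutSentences I) (λ _ → *-identityˡ _))

  app-extend : ∀ (f : GrDual) h → app f h ≈ NSym.extend (λ I → app f (H I)) h
  app-extend f []            = GrDual.0ᴹ-homo f
  app-extend f ((k , I) ∷ h) = begin
    app f ([ (k , I) ] ++ h)
      ≈⟨ GrDual.+ᴹ-homo f [ (k , I) ] h ⟩
    app f [ (k , I) ] + app f h
      -- The list `[ (k , I) ]` differs from `k` times `H I`, which is `[ (k * 1# , I) ]`, but has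
      -- the same coefficients.
      ≈⟨ +-cong (≈-trans (GrDual.⟦⟧-cong f (λ _ → +-congʳ (*-congʳ (≈-sym (*-identityʳ k)))))
                         (GrDual.*ₗ-homo f k (H I)))
                (app-extend f h) ⟩
    k * app f (H I) + NSym.extend (λ I → app f (H I)) h ∎

  -- This is the sum of all `M I` with coefficients `app g (H I)`, given coefficientwise by means of
  -- `at-M`.
  fromDual : GrDual → Series
  fromDual g = record
    { at      = λ u → app g (H (shape u))
    ; resp    = λ u~v → ≈-reflexive (cong (app g ∘ H) (shape-resp-~ u~v))
    ; bounded = proj₁ (GrDual.bounded g) , λ u lt → proj₂ (GrDual.bounded g)
        (subst (_ ℕ.<_) (≡.sym (∣shape∣ u)) lt) (H (shape u)) (homogeneous-H (shape u))
    }

  fromDual-QSym : ∀ g → QSym (fromDual g)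
  fromDual-QSym g = invariant⇒QSym (fromDual g) (λ _ _ eq → ≈-reflexive (cong (app g ∘ H) eq))

  dual-fromDual : ∀ g h → app (dual (fromDual g)) h ≈ app g h
  dual-fromDual g h = ≈-trans
    (extend-congˡ (λ I → ≈-reflexive (cong (app g ∘ H) (shape-representative I))) h)
    (≈-sym (app-extend g h))

  -- By `at-M` the values of `M I` at the representatives are those of a dual basis vector; the
  -- right-hand side is `app (H* I) h` by definition.
  dual-M : ∀ I h → app (dual (M I)) h ≈ NSym.coeff h I
  dual-M I = extend-congˡ λ J → ≈-trans (at-M I (representative J)) (≈-reflexive
    (≡.trans (cong (λ L → ⟦ I ≟ˢ L ⟧) (shape-representative J)) (⟦⟧-cong ≡.sym ≡.sym (I ≟ˢ J) (J ≟ˢ I))))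

  dual-+ : ∀ f g h → app (dual (f 𝕜[x].+ g)) h ≈ app (dual f) h + app (dual g) h
  dual-+ f g h = ≈-trans (∑-cong h (λ _ → distribˡ _ _ _)) (∑-+ _ _ h)

  -- Both sides are linear in `h`, so they are compared on each `H I`. There `at-product` and the
  -- definition of `ΔH` give the same sum over `cutSentences I`.
  dual-* : ∀ f g → ShapeInvariant f → ShapeInvariant g →
           ∀ h → app (dual (f 𝕜[x].* g)) h ≈ (dual f ⊗ dual g) (Δ h)
  dual-* f g f-inv g-inv h = ≈-trans (extend-congˡ on-basis h)
    (≈-sym (extend-Δ (λ (P , Q) → app (dual f) (H P) * app (dual g) (H Q)) h))
    where
    on-basis : ∀ I → at (f 𝕜[x].* g) (representative I) ≈ (dual f ⊗ dual g) (ΔH I)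
    on-basis I = begin
      at (f 𝕜[x].* g) (representative I)
        ≈⟨ at-product f g f-inv g-inv (representative I) ⟩
      ∑ (cutSentences (shape (representative I))) _
        ≈⟨ ≈-reflexive (cong (λ J → ∑ (cutSentences J) _) (shape-representative I)) ⟩
      ∑ (cutSentences I) (λ (P , Q) → at f (representative P) * at g (representative Q))
        ≈⟨ ∑-cong (cutSentences I) (λ (P , Q) → *-cong (dual-H f P) (dual-H g Q)) ⟨
      ∑ (cutSentences I) (λ (P , Q) → app (dual f) (H P) * app (dual g) (H Q))
        ≈⟨ ⊗-ΔH (dual f) (dual g) I ⟨
      (dual f ⊗ dual g) (ΔH I) ∎

  dual-1 : ∀ h → app (dual 𝕜[x].1#) h ≈ NSym.coeff h []
  dual-1 h = ≈-trans (extend-congˡ (λ I → ≈-sym (+-identityʳ _)) h) (dual-M [] h)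

  dual-0 : ∀ h → app (dual 𝕜[x].0#) h ≈ 0#
  dual-0 h = ∑-zero (All.universal (λ _ → zeroʳ _) h)

  dual-neg : ∀ f h → app (dual (𝕜[x].- f)) h ≈ - app (dual f) h
  dual-neg f h = ≈-trans (∑-cong h (λ _ → ≈-sym (-‿distribʳ-* _ _))) (∑-neg _ h)

  dual-· : ∀ k f h → app (dual (k 𝕜[x].· f)) h ≈ k * app (dual f) h
  dual-· k f h = ≈-trans (∑-cong h (λ _ → x∙yz≈y∙xz _ _ _)) (∑-* k _ h)

  -- The isomorphism

  dual-isIsomorphism :
    IsAlgebraIsomorphism (𝕜[x].subalgebra QSym-isSubalgebra) grDualAlgebra (dual ∘ proj₁)
  dual-isIsomorphism = record
    { isRingIsomorphism = record
      { isRingMonomorphism = record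
        { isRingHomomorphism = record
          { isSemiringHomomorphism = record
            { isNearSemiringHomomorphism = record
              { +-isMonoidHomomorphism = +-isMonoidHomomorphism
              ; *-homo = λ (f , p) (g , q) → dual-* f g (QSym⇒invariant f p)
                                                        (QSym⇒invariant g q)
              }
            ; 1#-homo = dual-1
            }
          ; -‿homo = λ (f , _) → dual-neg f
          }
        ; injective = λ {f} {g} → injective {f} {g}
        }
      ; surjective = surjective
      }
    ; isLeftModuleIsomorphism = record
      { isLeftModuleMonomorphism = record
        { isLeftModuleHomomorphism = record
          { +ᴹ-isGroupHomomorphism = record
            { isMonoidHomomorphism = +-isMonoidHomomorphism
            ; ⁻¹-homo = λ (f , _) → dual-neg f
            }
          ; *ₗ-homo = λ k (f , _) → dual-· k f
          }
        ; injective = λ {f} {g} → injective {f} {g}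
        }
      ; surjective = surjective
      }
    }
    where
    module QSymA = RawAlgebra (𝕜[x].subalgebra QSym-isSubalgebra)
    module NSymA* = RawAlgebra grDualAlgebra

    dual-cong : ∀ {f g} → f QSymA.≈ g → dual (proj₁ f) NSymA*.≈ dual (proj₁ g)
    dual-cong f≈g = extend-congˡ (λ I → f≈g (representative I))

    +-isMonoidHomomorphism : MonoidMorphisms.IsMonoidHomomorphism
      (RawLeftModule.+ᴹ-rawMonoid QSymA.rawLeftModule)
      (RawLeftModule.+ᴹ-rawMonoid NSymA*.rawLeftModule) (dual ∘ proj₁)
    +-isMonoidHomomorphism = record
      { isMagmaHomomorphism = record
        { isRelHomomorphism = record { cong = λ {f} {g} → dual-cong {f} {g} }
        ; homo = λ (f , _) (g , _) → dual-+ f g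
        }
      ; ε-homo = dual-0
      }

    injective : ∀ {f g} → dual (proj₁ f) NSymA*.≈ dual (proj₁ g) → f QSymA.≈ g
    -- A shape-invariant series is determined by its values at representatives, and these are the
    -- values of its dual on the basis.
    injective {f , p} {g , q} eq u = begin
      at f u                          ≈⟨ at-representative f (QSym⇒invariant f p) u ⟩
      at f (representative (shape u)) ≈⟨ dual-H f (shape u) ⟨
      app (dual f) (H (shape u))      ≈⟨ eq (H (shape u)) ⟩
      app (dual g) (H (shape u))      ≈⟨ dual-H g (shape u) ⟩
      at g (representative (shape u)) ≈⟨ at-representative g (QSym⇒invariant g q) u ⟨
      at g u                          ∎

    surjective : ∀ φ → Σ QSymA.Carrier λ f → ∀ {g} → g QSymA.≈ f → dual (proj₁ g) NSymA*.≈ φ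
    surjective φ = (fromDual φ , fromDual-QSym φ) , λ {g} g≈ h →
      -- Surjectivity concerns every `g` equal to the preimage `fromDual φ`, hence the appeal to
      -- `dual-cong`.
      ≈-trans (dual-cong {g} {fromDual φ , fromDual-QSym φ} g≈ h) (dual-fromDual φ h)

proposition4p2 : ∀ {c ℓ₁ ℓ₂ a} (𝕜 : HeytingField c ℓ₁ ℓ₂) → CharacteristicZero (fieldRing 𝕜) →
    ∀ {A : Set a} {n : ℕ} (finite : A ↔ Fin n) →
    let open Setup (fieldRing 𝕜) finite in
    Σ (𝕜[x].IsSubalgebra QSym) λ sub →
    let module QSymA = RawAlgebra (𝕜[x].subalgebra sub)
        module NSymA* = RawAlgebra grDualAlgebra in
    Σ (QSymA.Carrier → NSymA*.Carrier) λ Φ →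
      IsAlgebraIsomorphism (𝕜[x].subalgebra sub) grDualAlgebra Φ ×
      (∀ I → Φ (M I , M∈QSym I) NSymA*.≈ H* I)
proposition4p2 𝕜 _ finite = QSym-isSubalgebra , dual ∘ proj₁ , dual-isIsomorphism , dual-M
  where open Coefficients (fieldRing 𝕜) finite
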